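{- Let $G$ be a finite group and $\alpha\geq 1$. If $A,B\subset G$ are non-empty subsets with $e(A,B)\geq\alpha^{ -1}$, then there exist constants $\beta_1,\beta_2,\beta_3,\beta_4\geq 1$ with $$\beta_1\leq 2^{1861}\alpha^{720},\quad \beta_2\leq 2^{325}\alpha^{126},\quad\beta_3\leq 2^{2424}\alpha^{937},\quad \beta_4\leq 2^{930}\alpha^{360},$$ a $\beta_1$-approximate subgroup $\tilde H\subset G$ and elements $x,y\in G$ such that $$|\tilde H|\leq\beta_2|A|\leq\beta_2\alpha^2|B|,\qquad |A\cap x\tilde H|\geq\beta_3^{ -1}|A|,\qquad |B\cap\tilde H y|\geq\beta_3^{ -1}|B|,\qquad \frac{|\tilde H\cdot\tilde H\cdot\tilde H|}{|\tilde H|}\leq\beta_4.$$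
   Context: For subsets $A,B$ of a finite group $G$, the multiplicative energy is $E(A,B)=|\{(a_1,a_2,b_1,b_2)\in A^2\times B^2: a_1b_1=a_2b_2\}|$ and the normalized energy is $e(A,B)=E(A,B)/(|A||B|)^{3/2}$. For $\beta\geq 1$, a subset $\tilde H\subset G$ is a $\beta$-approximate subgroup if $1\in\tilde H$, $\tilde H=\tilde H^{ -1}$, and there is a symmetric subset $X\subset\tilde H\cdot\tilde H$ with $|X|\leq\beta$ and $\tilde H\cdot\tilde H\subset X\cdot\tilde H$.
   Formalization: The parameter α is taken to be a rational number rather than an arbitrary real number α ≥ 1; the constants β₁,…,β₄ produced are rational as well. -}

module Defs where

open import Data.Nat using (ℕ; zero; suc)
open import Data.Bool using (Bool; true; false; _∧_; if_then_else_)
open import Data.Fin using (Fin; _≟_)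
open import Data.Vec using (Vec; lookup; tabulate)
open import Data.List using (List; map; allFin)
open import Data.Nat.ListAction using (sum)
open import Data.Bool.ListAction using (any)
open import Data.Fin.Subset using (Subset; _∈_; _⊆_; ∣_∣)
open import Data.Integer using (+_)
open import Data.Rational using (ℚ; _/_; _*_; 1ℚ; _≤_)
open import Data.Product using (Σ; _×_)
open import Relation.Binary.PropositionalEquality using (_≡_)
open import Relation.Nullary.Decidable using (⌊_⌋)
open import Algebra.Structures using (IsGroup)

-- A finite group: a group structure on Fin n (with propositional equality).
-- Every finite group is isomorphic to one of these.
record FinGroup (n : ℕ) : Set where
  field
    _∙_     : Fin n → Fin n → Fin n
    ε       : Fin n
    _⁻¹     : Fin n → Fin n
    isGroup : IsGroup _≡_ _∙_ ε _⁻¹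

ℕ→ℚ : ℕ → ℚ
ℕ→ℚ k = + k / 1

_^ℚ_ : ℚ → ℕ → ℚ
q ^ℚ zero = 1ℚ
q ^ℚ suc k = q * (q ^ℚ k)

Σfin : (n : ℕ) → (Fin n → ℕ) → ℕ
Σfin n f = sum (map f (allFin n))

𝟙 : Bool → ℕ
𝟙 true = 1
𝟙 false = 0

module _ {n : ℕ} (G : FinGroup n) where
  open FinGroup G

  prodSet : Subset n → Subset n → Subset n
  prodSet A B = tabulate λ g →
    any (λ a → any (λ b → lookup A a ∧ lookup B b ∧ ⌊ (a ∙ b) ≟ g ⌋) (allFin n)) (allFin n)

  invSet : Subset n → Subset n
  invSet A = tabulate λ g → lookup A (g ⁻¹)

  leftTr : Fin n → Subset n → Subset n
  leftTr x H = tabulate λ g → lookup H ((x ⁻¹) ∙ g)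

  rightTr : Subset n → Fin n → Subset n
  rightTr H y = tabulate λ g → lookup H (g ∙ (y ⁻¹))

  energy : Subset n → Subset n → ℕ
  energy A B =
    Σfin n λ a₁ → Σfin n λ a₂ → Σfin n λ b₁ → Σfin n λ b₂ →
      𝟙 (lookup A a₁ ∧ lookup A a₂ ∧ lookup B b₁ ∧ lookup B b₂ ∧ ⌊ (a₁ ∙ b₁) ≟ (a₂ ∙ b₂) ⌋)

  IsApproxSubgroup : ℚ → Subset n → Set
  IsApproxSubgroup β H =
    ε ∈ H × invSet H ≡ H ×
    Σ (Subset n) λ X →
      invSet X ≡ X × X ⊆ prodSet H H × ℕ→ℚ ∣ X ∣ ≤ β × prodSet H H ⊆ prodSet X H

module Submission where

-- Write E(A,B) as the sum over p of |A ∩ pB⁻¹|².  Choosing p suitably, P = A ∩ pB⁻¹ is large and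
-- x⁻¹c lies, for all but few pairs (x,c) ∈ P², in the set D of popular quotients of B, whose size
-- is O(|A|).  Discarding the x ∈ P with many bad partners leaves X ⊆ P such that every x⁻¹y with
-- x, y ∈ X has many factorisations over D (paths of length two through P), so |X⁻¹X| ≤ K|X|.
-- The set S of those s with |X ∩ sX| ≥ |X|/2K is symmetric, contains 1, and satisfies
-- |X⁻¹Sᵐ| ≤ (2K²)ᵐ|X|, because each letter of a word in S can be routed through |X|/2K elements
-- of X.  By Cauchy–Schwarz some X ∩ Sd is large; since X ⊆ A and X⁻¹p ⊆ B, the conjugate
-- H = d⁻¹S²d meets A in d H and B in H d⁻¹p as required, and Ruzsa's covering lemma applied to
-- S⁴ and S makes H an approximate subgroup.
-- All constants are powers of 2 and of an integer k with α ≤ k ≤ 2α: one may take K = 2¹⁸k⁸.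

-- Without commutativity a small quotient set X⁻¹X does not keep longer products small: if X is a
-- subgroup Γ with one further element x, then |X⁻¹X| ≤ 3|Γ|, while triple products from X contain
-- ΓxΓ. Hence X is abandoned for the set S of its approximate symmetries, whose words can be
-- shortened letter by letter.
--
-- S² rather than S becomes the approximate subgroup because covering places g ∈ S⁴ only in C S S⁻¹,
-- and S S⁻¹ ⊆ S². The conjugation reconciles the two sides: c ∈ Sd says both c ∈ d(d⁻¹Sd) and c⁻¹p
-- ∈ (d⁻¹Sd)d⁻¹p, so one set yields a left coset for A and a right coset for B.
--
-- All combinatorics runs over ℕ with divisions cleared. The energy enters only through |A|²|B| ≤
-- k²E and |A||B|² ≤ k²E. These give |A| ≤ 4k²|P| and |D| ≤ w|P| with w = 2⁸k⁴; then X⁻¹X lies in a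
-- set of at most 4w²|X| elements, and K = 4w².

open import Defs

-- Natural numbers inside ℚ, and powers of rationals.

module RationalPowers where
  import Data.Nat as ℕ
  import Data.Nat.Properties as ℕ
  open import Data.Nat using (ℕ; zero; suc)
  open import Data.Nat.DivMod using (m≡m%n+[m/n]*n; m%n<n; m/n*n≤m)
  open import Data.Integer using (+_; +≤+)
  import Data.Integer as ℤ
  import Data.Integer.Properties as ℤ
  open import Data.Rational
  open import Data.Rational.Properties
  import Data.Rational.Unnormalised as ℚᵘ
  import Data.Rational.Unnormalised.Properties as ℚᵘ
  open import Data.Product using (∃; _×_; _,_)
  open import Function using (_$_)
  open import Relation.Binary.PropositionalEquality

  private
    -- Normalised rationals carry a gcd computation that is stuck on a variable `k`. In the
    -- unnormalised form the denominator is literally 1, so order and products of `ℕ→ℚ` are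
    -- transported through it.
    toℚᵘ-ℕ→ℚ : ∀ k → toℚᵘ (ℕ→ℚ k) ℚᵘ.≃ ℚᵘ.mkℚᵘ (+ k) 0
    toℚᵘ-ℕ→ℚ k = toℚᵘ-fromℚᵘ (ℚᵘ.mkℚᵘ (+ k) 0)

  ℕ→ℚ-mono : ∀ {m n} → m ℕ.≤ n → ℕ→ℚ m ≤ ℕ→ℚ n
  ℕ→ℚ-mono {m} {n} m≤n = toℚᵘ-cancel-≤ $
    ℚᵘ.≤-respˡ-≃ (ℚᵘ.≃-sym (toℚᵘ-ℕ→ℚ m)) $ ℚᵘ.≤-respʳ-≃ (ℚᵘ.≃-sym (toℚᵘ-ℕ→ℚ n)) $
    ℚᵘ.*≤* (ℤ.*-monoʳ-≤-nonNeg (+ 1) (+≤+ m≤n))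

  ℕ→ℚ-cancel : ∀ {m n} → ℕ→ℚ m ≤ ℕ→ℚ n → m ℕ.≤ n
  ℕ→ℚ-cancel {m} {n} p
    with ℚᵘ.*≤* q ← ℚᵘ.≤-respˡ-≃ (toℚᵘ-ℕ→ℚ m) (ℚᵘ.≤-respʳ-≃ (toℚᵘ-ℕ→ℚ n) (toℚᵘ-mono-≤ p))
    = ℤ.drop‿+≤+ (ℤ.*-cancelʳ-≤-pos (+ m) (+ n) (+ 1) q)

  ℕ→ℚ-* : ∀ m n → ℕ→ℚ (m ℕ.* n) ≡ ℕ→ℚ m * ℕ→ℚ n
  ℕ→ℚ-* m n = toℚᵘ-injective $ begin
    toℚᵘ (ℕ→ℚ (m ℕ.* n))                     ≈⟨ toℚᵘ-ℕ→ℚ (m ℕ.* n) ⟩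
    ℚᵘ.mkℚᵘ (+ (m ℕ.* n)) 0                  ≡⟨ cong (λ z → ℚᵘ.mkℚᵘ z 0) (ℤ.pos-* m n) ⟩
    ℚᵘ.mkℚᵘ (+ m) 0 ℚᵘ.* ℚᵘ.mkℚᵘ (+ n) 0     ≈⟨ ℚᵘ.*-cong (toℚᵘ-ℕ→ℚ m) (toℚᵘ-ℕ→ℚ n) ⟨
    toℚᵘ (ℕ→ℚ m) ℚᵘ.* toℚᵘ (ℕ→ℚ n)           ≈⟨ toℚᵘ-homo-* (ℕ→ℚ m) (ℕ→ℚ n) ⟨
    toℚᵘ (ℕ→ℚ m * ℕ→ℚ n)                     ∎
    where open ℚᵘ.≃-Reasoning

  ℕ→ℚ-^ : ∀ m k → ℕ→ℚ (m ℕ.^ k) ≡ ℕ→ℚ m ^ℚ k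
  ℕ→ℚ-^ m zero = refl
  ℕ→ℚ-^ m (suc k) = trans (ℕ→ℚ-* m (m ℕ.^ k)) (cong (ℕ→ℚ m *_) (ℕ→ℚ-^ m k))

  0≤ℕ→ℚ : ∀ k → 0ℚ ≤ ℕ→ℚ k
  0≤ℕ→ℚ k = ℕ→ℚ-mono {0} {k} ℕ.z≤n

  *-mono-≤₀ : ∀ {p q r s} → 0ℚ ≤ p → 0ℚ ≤ s → p ≤ q → r ≤ s → p * r ≤ q * s
  *-mono-≤₀ {p} {q} {r} {s} 0≤p 0≤s p≤q r≤s = ≤-trans
    (*-monoˡ-≤-nonNeg p {{nonNegative 0≤p}} r≤s) (*-monoʳ-≤-nonNeg s {{nonNegative 0≤s}} p≤q)

  *-nonneg : ∀ {p q} → 0ℚ ≤ p → 0ℚ ≤ q → 0ℚ ≤ p * q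
  *-nonneg {p} {q} 0≤p 0≤q = subst (_≤ p * q) (*-zeroʳ p) (*-monoˡ-≤-nonNeg p {{nonNegative 0≤p}} 0≤q)

  ^ℚ-nonneg : ∀ {q} k → 0ℚ ≤ q → 0ℚ ≤ q ^ℚ k
  ^ℚ-nonneg zero _ = 0≤ℕ→ℚ 1
  ^ℚ-nonneg (suc k) 0≤q = *-nonneg 0≤q (^ℚ-nonneg k 0≤q)

  ^ℚ-mono : ∀ {p q} k → 0ℚ ≤ p → p ≤ q → p ^ℚ k ≤ q ^ℚ k
  ^ℚ-mono zero _ _ = ≤-refl
  ^ℚ-mono (suc k) 0≤p p≤q = *-mono-≤₀ 0≤p (^ℚ-nonneg k (≤-trans 0≤p p≤q)) p≤q (^ℚ-mono k 0≤p p≤q)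

  ^ℚ-+ : ∀ q j k → q ^ℚ (j ℕ.+ k) ≡ q ^ℚ j * q ^ℚ k
  ^ℚ-+ q zero k = sym (*-identityˡ (q ^ℚ k))
  ^ℚ-+ q (suc j) k = trans (cong (q *_) (^ℚ-+ q j k)) (sym (*-assoc q (q ^ℚ j) (q ^ℚ k)))

  interchange : ∀ a b c d → (a * b) * (c * d) ≡ (a * c) * (b * d)
  interchange a b c d = begin
    (a * b) * (c * d)  ≡⟨ *-assoc a b (c * d) ⟩
    a * (b * (c * d))
      ≡⟨ cong (a *_) (trans (sym (*-assoc b c d)) (trans (cong (_* d) (*-comm b c)) (*-assoc c b d))) ⟩
    a * (c * (b * d))  ≡⟨ *-assoc a c (b * d) ⟨
    (a * c) * (b * d)  ∎
    where open ≡-Reasoning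

  ^ℚ-distrib-* : ∀ p q k → (p * q) ^ℚ k ≡ p ^ℚ k * q ^ℚ k
  ^ℚ-distrib-* p q zero = refl
  ^ℚ-distrib-* p q (suc k) = trans (cong (p * q *_) (^ℚ-distrib-* p q k)) (interchange p q (p ^ℚ k) (q ^ℚ k))

  1≤^ℚ : ∀ {q} k → 1ℚ ≤ q → 1ℚ ≤ q ^ℚ k
  1≤^ℚ zero _ = ≤-refl
  1≤^ℚ {q} (suc k) 1≤q = *-mono-≤₀ (0≤ℕ→ℚ 1) (^ℚ-nonneg k (≤-trans (0≤ℕ→ℚ 1) 1≤q)) 1≤q (1≤^ℚ k 1≤q)

  ^ℚ-monoʳ : ∀ {q j k} → 1ℚ ≤ q → j ℕ.≤ k → q ^ℚ j ≤ q ^ℚ k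
  ^ℚ-monoʳ {q} {j} 1≤q j≤k with d , refl ← ℕ.m≤n⇒∃[o]m+o≡n j≤k =
    subst₂ _≤_ (*-identityʳ (q ^ℚ j)) (sym (^ℚ-+ q j d))
      (*-monoˡ-≤-nonNeg (q ^ℚ j) {{nonNegative (^ℚ-nonneg j (≤-trans (0≤ℕ→ℚ 1) 1≤q))}} (1≤^ℚ d 1≤q))

  -- Take k = ⌊α⌋ + 1; the added 1 is at most α because α ≥ 1. The price of an integer parameter is
  -- one factor 2 per power of α, which the exponents of 2 in the theorem can afford.
  natural-upper : ∀ α → 1ℚ ≤ α → ∃ λ k → α ≤ ℕ→ℚ k × ℕ→ℚ k ≤ ℕ→ℚ 2 * α
  natural-upper (mkℚ (+ p) d-1 c) 1≤α = k , α≤k , k≤2α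
    where
    d = suc d-1
    k = suc (p ℕ./ d)
    α = mkℚ (+ p) d-1 c
    d≤p : d ℕ.≤ p
    d≤p = ℤ.drop‿+≤+ (subst₂ ℤ._≤_ (ℤ.*-identityˡ (+ d)) (ℤ.*-identityʳ (+ p)) (drop-*≤* 1≤α))
    p≤kd : p ℕ.≤ k ℕ.* d
    p≤kd = ℕ.≤-trans (ℕ.≤-reflexive (m≡m%n+[m/n]*n p d)) (ℕ.+-monoˡ-≤ (p ℕ./ d ℕ.* d) (ℕ.<⇒≤ (m%n<n p d)))
    kd≤2p : k ℕ.* d ℕ.≤ 2 ℕ.* p
    kd≤2p = ℕ.≤-trans (ℕ.+-mono-≤ d≤p (m/n*n≤m p d)) (ℕ.≤-reflexive (cong (p ℕ.+_) (sym (ℕ.+-identityʳ p))))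
    α≤k : α ≤ ℕ→ℚ k
    α≤k = toℚᵘ-cancel-≤ $ ℚᵘ.≤-respʳ-≃ (ℚᵘ.≃-sym (toℚᵘ-ℕ→ℚ k)) $ ℚᵘ.*≤* $
      subst₂ ℤ._≤_ (sym (ℤ.*-identityʳ (+ p))) (ℤ.pos-* k d) (+≤+ p≤kd)
    k≤2α : ℕ→ℚ k ≤ ℕ→ℚ 2 * α
    k≤2α = toℚᵘ-cancel-≤ $ ℚᵘ.≤-respˡ-≃ (ℚᵘ.≃-sym (toℚᵘ-ℕ→ℚ k)) $
      ℚᵘ.≤-respʳ-≃ (ℚᵘ.≃-sym (toℚᵘ-homo-* (ℕ→ℚ 2) α)) $ ℚᵘ.*≤* $
      subst₂ ℤ._≤_ (trans (ℤ.pos-* k d) (cong (λ z → + k ℤ.* + z) (sym (ℕ.*-identityˡ d))))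
        (trans (ℤ.pos-* 2 p) (sym (ℤ.*-identityʳ (+ 2 ℤ.* + p)))) (+≤+ kd≤2p)
  natural-upper (mkℚ ℤ.-[1+ p ] d-1 c) (*≤* ())

-- Sums of indicator functions.

module Counting where
  open RationalPowers using (ℕ→ℚ-mono)
  open import Data.Nat hiding (_≟_)
  open import Data.Nat.Properties hiding (_≟_)
  open import Data.Nat.Solver using (module +-*-Solver)
  import Data.Nat.ListAction as ListAction
  open import Data.Bool using (Bool; true; false; _∧_; not)
  open import Data.Bool.Properties using (T-≡; T-∧)
  open import Data.Fin using (Fin; zero; suc; _≟_)
  open import Data.Fin.Properties using (any?)
  open import Data.Fin.Subset using (Subset; Nonempty; ∣_∣; _∩_; _∈_; _⊆_; _∪_; ⁅_⁆; ⊥)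
  open import Data.Fin.Subset.Properties
  open import Data.Fin.Permutation using (Permutation; permutation; _⟨$⟩ʳ_)
  open import Data.List using (List; []; _∷_; allFin)
  import Data.List as List
  import Data.List.Properties as List
  import Data.List.Membership.Propositional as List
  open import Data.List.Membership.Propositional.Properties using (∈-allFin)
  open import Data.List.Relation.Unary.Any using (here; there; satisfied)
  open import Data.List.Relation.Unary.Any.Properties using (any⁺; any⁻)
  open import Data.Vec using ([]; _∷_; lookup; tabulate)
  open import Data.Vec.Properties using (lookup∘tabulate; []=⇒lookup; lookup⇒[]=)
  open import Data.Product using (Σ; ∃; ∃₂; _×_; _,_; proj₁; proj₂)
  open import Data.Sum using (inj₁; inj₂; [_,_]′)
  open import Function using (_∘_; id; _$_)
  open import Function.Bundles using (module Equivalence)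
  open import Relation.Nullary
  open import Relation.Nullary.Decidable using (⌊_⌋; toWitness; fromWitness; isYes≗does; dec-true)
  open import Relation.Binary.PropositionalEquality
  open import Algebra.Bundles using (Group)
  open import Algebra.Structures using (IsGroup)
  open import Algebra.Properties.Semiring.Sum +-*-semiring
    as Sum using (sum; sum-cong-≗; ∑-distrib-+; *-distribˡ-sum; *-distribʳ-sum; sum-permute)
  open +-*-Solver using (solve; _:+_; _:*_; _:=_; con)
  open Equivalence using (to; from)

  private variable
    n : ℕ

  χ : Subset n → Fin n → ℕ
  χ A i = 𝟙 (lookup A i)

  opaque
    ∑ : (Fin n → ℕ) → ℕ
    ∑ = sum

    ∑-cong : {f g : Fin n → ℕ} → (∀ i → f i ≡ g i) → ∑ f ≡ ∑ g
    ∑-cong = sum-cong-≗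

    ∑-mono : {f g : Fin n → ℕ} → (∀ i → f i ≤ g i) → ∑ f ≤ ∑ g
    ∑-mono {zero} f≤g = z≤n
    ∑-mono {suc n} f≤g = +-mono-≤ (f≤g zero) (∑-mono (f≤g ∘ suc))

    term≤∑ : (f : Fin n → ℕ) (i : Fin n) → f i ≤ ∑ f
    term≤∑ f zero = m≤m+n _ _
    term≤∑ f (suc i) = ≤-trans (term≤∑ (f ∘ suc) i) (m≤n+m _ _)

    ∑-+ : (f g : Fin n → ℕ) → ∑ (λ i → f i + g i) ≡ ∑ f + ∑ g
    ∑-+ = ∑-distrib-+

    ∑-*ˡ : (c : ℕ) (f : Fin n → ℕ) → ∑ (λ i → c * f i) ≡ c * ∑ f
    ∑-*ˡ c f = sym (*-distribˡ-sum c f)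

    ∑-*ʳ : (c : ℕ) (f : Fin n → ℕ) → ∑ (λ i → f i * c) ≡ ∑ f * c
    ∑-*ʳ c f = sym (*-distribʳ-sum c f)

    ∑-comm : (f : Fin n → Fin n → ℕ) → ∑ (λ i → ∑ (f i)) ≡ ∑ (λ j → ∑ λ i → f i j)
    ∑-comm = Sum.∑-comm

    ∑-permute : (f : Fin n → ℕ) (π : Permutation n n) → ∑ f ≡ ∑ (λ i → f (π ⟨$⟩ʳ i))
    ∑-permute = sum-permute

    Σfin≡∑ : (f : Fin n → ℕ) → Σfin n f ≡ ∑ f
    Σfin≡∑ f = trans (cong ListAction.sum (List.map-tabulate id f)) (go f)
      where
      go : ∀ {m} (f : Fin m → ℕ) → ListAction.sum (List.tabulate f) ≡ ∑ f
      go {zero} f = refl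
      go {suc m} f = cong (f zero +_) (go (f ∘ suc))

    card : (A : Subset n) → ∣ A ∣ ≡ ∑ (χ A)
    card [] = refl
    card (true ∷ A) = cong suc (card A)
    card (false ∷ A) = card A

  ∑-*-∑ : (f g : Fin n → ℕ) → ∑ f * ∑ g ≡ ∑ (λ i → ∑ (λ j → f i * g j))
  ∑-*-∑ f g = trans (sym (∑-*ʳ (∑ g) f)) (∑-cong λ i → sym (∑-*ˡ (f i) g))

  -- All averaging arguments take this form: two requirements on an element are merged into one
  -- strict inequality, which is then summed.
  ∑-<⇒∃ : {f g : Fin n → ℕ} → ∑ f < ∑ g → ∃ λ i → f i < g i
  ∑-<⇒∃ {f = f} {g} lt with any? (λ i → f i <? g i)
  ... | yes p = p
  ... | no ¬p = contradiction lt (≤⇒≯ (∑-mono λ i → ≮⇒≥ λ q → ¬p (i , q)))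

  Σfin-cong : {f g : Fin n → ℕ} → (∀ i → f i ≡ g i) → Σfin n f ≡ ∑ g
  Σfin-cong {f = f} f≡g = trans (Σfin≡∑ f) (∑-cong f≡g)

  𝟙-∧ : ∀ p q → 𝟙 (p ∧ q) ≡ 𝟙 p * 𝟙 q
  𝟙-∧ true q = sym (+-identityʳ _)
  𝟙-∧ false q = refl

  𝟙≤1 : ∀ p → 𝟙 p ≤ 1
  𝟙≤1 true = ≤-refl
  𝟙≤1 false = z≤n

  𝟙² : ∀ p → 𝟙 p * 𝟙 p ≡ 𝟙 p
  𝟙² true = refl
  𝟙² false = refl

  χ-∈ : {A : Subset n} {i : Fin n} → i ∈ A → χ A i ≡ 1
  χ-∈ i∈A rewrite []=⇒lookup i∈A = refl

  χ*x≤x : (A : Subset n) (i : Fin n) (x : ℕ) → χ A i * x ≤ x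
  χ*x≤x A i x = ≤-trans (*-monoˡ-≤ x (𝟙≤1 (lookup A i))) (≤-reflexive (*-identityˡ x))

  x*χ≤x : (A : Subset n) (i : Fin n) (x : ℕ) → x * χ A i ≤ x
  x*χ≤x A i x = ≤-trans (*-monoʳ-≤ x (𝟙≤1 (lookup A i))) (≤-reflexive (*-identityʳ x))

  χ-guard : (A : Subset n) (i : Fin n) {x y : ℕ} → (i ∈ A → x ≤ y) → χ A i * x ≤ χ A i * y
  χ-guard A i h with lookup A i in eq
  ... | true = *-monoʳ-≤ 1 (h (lookup⇒[]= i A eq))
  ... | false = z≤n

  χ-≤ : (A : Subset n) (i : Fin n) {y : ℕ} → (i ∈ A → 1 ≤ y) → χ A i ≤ y
  χ-≤ A i h with lookup A i in eq
  ... | true = h (lookup⇒[]= i A eq)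
  ... | false = z≤n

  χ-mono : (A B : Subset n) {i j : Fin n} → (i ∈ A → j ∈ B) → χ A i ≤ χ B j
  χ-mono A B h = χ-≤ A _ λ i∈A → ≤-reflexive (sym (χ-∈ (h i∈A)))

  χ-pos : (A : Subset n) {i : Fin n} → 0 < χ A i → i ∈ A
  χ-pos A {i} p with lookup A i in eq
  ... | true = lookup⇒[]= i A eq

  ∈-tabulate⁺ : (f : Fin n → Bool) {i : Fin n} → f i ≡ true → i ∈ tabulate f
  ∈-tabulate⁺ f {i} p = lookup⇒[]= i _ (trans (lookup∘tabulate f i) p)

  ∈-tabulate⁻ : (f : Fin n → Bool) {i : Fin n} → i ∈ tabulate f → f i ≡ true
  ∈-tabulate⁻ f {i} p = trans (sym (lookup∘tabulate f i)) ([]=⇒lookup p)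

  setOf : {P : Fin n → Set} → (∀ i → Dec (P i)) → Subset n
  setOf P? = tabulate λ i → ⌊ P? i ⌋

  module _ {P : Fin n → Set} (P? : ∀ i → Dec (P i)) where

    ∈-setOf⁺ : {i : Fin n} → P i → i ∈ setOf P?
    ∈-setOf⁺ {i} p = ∈-tabulate⁺ _ (trans (isYes≗does (P? i)) (dec-true (P? i) p))

    ∈-setOf⁻ : {i : Fin n} → i ∈ setOf P? → P i
    ∈-setOf⁻ {i} q with P? i | ∈-tabulate⁻ (λ i → ⌊ P? i ⌋) q
    ... | yes p | _ = p

  card-pos : {A : Subset n} → Nonempty A → 0 < ∣ A ∣
  card-pos {A = A} (i , i∈A) =
    subst (0 <_) (sym (card A)) (≤-trans (≤-reflexive (sym (χ-∈ i∈A))) (term≤∑ (χ A) i))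

  ∑-δ : (x : Fin n) (f : Fin n → ℕ) → ∑ (λ i → f i * 𝟙 ⌊ x ≟ i ⌋) ≡ f x
  ∑-δ x f = begin
    ∑ (λ i → f i * 𝟙 ⌊ x ≟ i ⌋)  ≡⟨ ∑-cong pointwise ⟩
    ∑ (λ i → f x * χ ⁅ x ⁆ i)    ≡⟨ ∑-*ˡ (f x) (χ ⁅ x ⁆) ⟩
    f x * ∑ (χ ⁅ x ⁆)            ≡⟨ cong (f x *_) (trans (sym (card ⁅ x ⁆)) (∣⁅x⁆∣≡1 x)) ⟩
    f x * 1                      ≡⟨ *-identityʳ (f x) ⟩
    f x                          ∎
    where
    open ≡-Reasoning
    pointwise : ∀ i → f i * 𝟙 ⌊ x ≟ i ⌋ ≡ f x * χ ⁅ x ⁆ i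
    pointwise i with x ≟ i
    ... | yes refl = cong (f x *_) (sym (χ-∈ (x∈⁅x⁆ x)))
    ... | no x≢i with lookup ⁅ x ⁆ i in eq
    ...   | true = contradiction (sym (x∈⁅y⁆⇒x≡y x (lookup⇒[]= i ⁅ x ⁆ eq))) x≢i
    ...   | false = trans (*-zeroʳ (f i)) (sym (*-zeroʳ (f x)))

  ∑-pos : {f : Fin n → ℕ} → 0 < ∑ f → ∃ λ i → 0 < f i
  ∑-pos {n = n} {f} p = ∑-<⇒∃ {f = λ _ → 0} (subst (_< ∑ f) (sym (∑-*ˡ 0 (λ _ → 0))) p)

  *-pos : ∀ {x y} → 0 < x → 0 < y → 0 < x * y
  *-pos {suc x} {suc y} _ _ = s≤s z≤n

  *-pos⁻ : ∀ x y → 0 < x * y → 0 < x × 0 < y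
  *-pos⁻ (suc x) zero p = contradiction (subst (0 <_) (*-zeroʳ x) p) λ ()
  *-pos⁻ (suc x) (suc y) p = s≤s z≤n , s≤s z≤n

  cancelˡ-≤ : ∀ {c x y} → 0 < c → c * x ≤ c * y → x ≤ y
  cancelˡ-≤ {suc c} _ = *-cancelˡ-≤ (suc c)

  2xy≤x²+y² : ∀ x y → 2 * (x * y) ≤ x * x + y * y
  2xy≤x²+y² x y = [ ordered x y , swapped ∘ ordered y x ]′ (≤-total x y)
    where
    swapped : 2 * (y * x) ≤ y * y + x * x → 2 * (x * y) ≤ x * x + y * y
    swapped = subst₂ _≤_ (cong (2 *_) (*-comm y x)) (+-comm (y * y) (x * x))
    ordered : ∀ x y → x ≤ y → 2 * (x * y) ≤ x * x + y * y
    ordered x y x≤y with d , refl ← m≤n⇒∃[o]m+o≡n x≤y =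
      subst (2 * (x * (x + d)) ≤_)
        (solve 2 (λ x d → con 2 :* (x :* (x :+ d)) :+ d :* d := x :* x :+ (x :+ d) :* (x :+ d)) refl x d)
        (m≤m+n _ (d * d))

  -- Both sides become double sums, compared term by term through 2xy ≤ x² + y². The support
  -- condition makes both indicators 1 wherever the left term is nonzero.
  cauchy-schwarz : (A : Subset n) (q : Fin n → ℕ) → (∀ i → 0 < q i → i ∈ A) →
    ∑ q * ∑ q ≤ ∣ A ∣ * ∑ (λ i → q i * q i)
  cauchy-schwarz A q supp = cancelˡ-≤ {2} (s≤s z≤n) $ begin
    2 * (∑ q * ∑ q)                          ≡⟨ cong (2 *_) (∑-*-∑ q q) ⟩
    2 * ∑ (λ i → ∑ λ j → q i * q j)          ≡⟨ ∑-*ˡ 2 _ ⟨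
    ∑ (λ i → 2 * ∑ λ j → q i * q j)          ≡⟨ ∑-cong (λ i → ∑-*ˡ 2 _) ⟨
    ∑ (λ i → ∑ λ j → 2 * (q i * q j))        ≤⟨ ∑-mono (λ i → ∑-mono λ j → pointwise i j) ⟩
    ∑ (λ i → ∑ λ j → q i * q i * χ A j + χ A i * (q j * q j))
      ≡⟨ trans (∑-cong λ i → ∑-+ _ _) (∑-+ _ _) ⟩
    ∑ (λ i → ∑ λ j → q i * q i * χ A j) + ∑ (λ i → ∑ λ j → χ A i * (q j * q j))
      ≡⟨ cong₂ _+_ (∑-*-∑ (λ i → q i * q i) (χ A)) (∑-*-∑ (χ A) (λ i → q i * q i)) ⟨
    Q * ∑ (χ A) + ∑ (χ A) * Q
      ≡⟨ solve 2 (λ x y → x :* y :+ y :* x := con 2 :* (y :* x)) refl Q (∑ (χ A)) ⟩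
    2 * (∑ (χ A) * Q)                        ≡⟨ cong (λ c → 2 * (c * Q)) (card A) ⟨
    2 * (∣ A ∣ * Q)                          ∎
    where
    open ≤-Reasoning
    Q = ∑ (λ i → q i * q i)
    pointwise : ∀ i j → 2 * (q i * q j) ≤ q i * q i * χ A j + χ A i * (q j * q j)
    pointwise i j with q i in qi | q j in qj
    ... | zero | _ = z≤n
    ... | suc x | zero = ≤-trans (≤-reflexive (cong (2 *_) (*-zeroʳ (suc x)))) z≤n
    ... | suc x | suc y
      rewrite χ-∈ (supp i (subst (0 <_) (sym qi) (s≤s z≤n)))
            | χ-∈ (supp j (subst (0 <_) (sym qj) (s≤s z≤n))) =
      ≤-trans (2xy≤x²+y² (suc x) (suc y))
        (≤-reflexive (cong₂ _+_ (sym (*-identityʳ (suc x * suc x))) (sym (*-identityˡ (suc y * suc y)))))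

  ∣p∪q∣≤∣p∣+∣q∣ : (p q : Subset n) → ∣ p ∪ q ∣ ≤ ∣ p ∣ + ∣ q ∣
  ∣p∪q∣≤∣p∣+∣q∣ [] [] = z≤n
  ∣p∪q∣≤∣p∣+∣q∣ (true ∷ p) (true ∷ q) = s≤s (≤-trans (∣p∪q∣≤∣p∣+∣q∣ p q) (+-monoʳ-≤ ∣ p ∣ (n≤1+n ∣ q ∣)))
  ∣p∪q∣≤∣p∣+∣q∣ (true ∷ p) (false ∷ q) = s≤s (∣p∪q∣≤∣p∣+∣q∣ p q)
  ∣p∪q∣≤∣p∣+∣q∣ (false ∷ p) (true ∷ q) = ≤-trans (s≤s (∣p∪q∣≤∣p∣+∣q∣ p q)) (≤-reflexive (sym (+-suc ∣ p ∣ ∣ q ∣)))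
  ∣p∪q∣≤∣p∣+∣q∣ (false ∷ p) (false ∷ q) = ∣p∪q∣≤∣p∣+∣q∣ p q

  -- Autocorrelation, fibres and multiplicative energy.

  module GroupCounting {n : ℕ} (G : FinGroup n) where
    open FinGroup G public renaming (_∙_ to infixl 8 _∙_; _⁻¹ to infix 9 _⁻¹)
    open IsGroup (FinGroup.isGroup G) public using (assoc; identityˡ; identityʳ; inverseʳ)

    group : Group _ _
    group = record { isGroup = FinGroup.isGroup G }

    open import Algebra.Properties.Group group public
      using (ε⁻¹≈ε; ⁻¹-involutive; ⁻¹-anti-homo-∙; ⁻¹-anti-homo-\\;
        \\-leftDividesˡ; \\-leftDividesʳ; //-rightDividesˡ; //-rightDividesʳ)

    ∑-translateˡ : (g : Fin n) (f : Fin n → ℕ) → ∑ f ≡ ∑ (λ i → f (g ∙ i))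
    ∑-translateˡ g f = ∑-permute f
      (permutation (g ∙_) (g ⁻¹ ∙_) (\\-leftDividesˡ g) (\\-leftDividesʳ g))

    ∑-translateʳ : (g : Fin n) (f : Fin n → ℕ) → ∑ f ≡ ∑ (λ i → f (i ∙ g))
    ∑-translateʳ g f = ∑-permute f
      (permutation (_∙ g) (_∙ g ⁻¹) (//-rightDividesˡ g) (//-rightDividesʳ g))

    ∑-inv : (f : Fin n → ℕ) → ∑ f ≡ ∑ (λ i → f (i ⁻¹))
    ∑-inv f = ∑-permute f (permutation _⁻¹ _⁻¹ ⁻¹-involutive ⁻¹-involutive)

    inv-cancel : ∀ x y z → (x ⁻¹ ∙ y) ⁻¹ ∙ (x ⁻¹ ∙ z) ≡ y ⁻¹ ∙ z
    inv-cancel x y z = begin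
      (x ⁻¹ ∙ y) ⁻¹ ∙ (x ⁻¹ ∙ z)  ≡⟨ cong (_∙ (x ⁻¹ ∙ z)) (⁻¹-anti-homo-\\ x y) ⟩
      (y ⁻¹ ∙ x) ∙ (x ⁻¹ ∙ z)     ≡⟨ assoc _ _ _ ⟩
      y ⁻¹ ∙ (x ∙ (x ⁻¹ ∙ z))     ≡⟨ cong (y ⁻¹ ∙_) (\\-leftDividesˡ x z) ⟩
      y ⁻¹ ∙ z                    ∎
      where open ≡-Reasoning

    -- For h = χ B this is ∣ B ∩ gB ∣.
    autocorr : (Fin n → ℕ) → Fin n → ℕ
    autocorr h g = ∑ λ p → h p * h (g ⁻¹ ∙ p)

    -- Left translation by x⁻¹ shows that |xB ∩ yB| depends only on x⁻¹y.
    autocorr-shift : (h : Fin n → ℕ) (x y : Fin n) →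
      ∑ (λ p → h (x ⁻¹ ∙ p) * h (y ⁻¹ ∙ p)) ≡ autocorr h (x ⁻¹ ∙ y)
    autocorr-shift h x y = sym (trans (∑-translateˡ (x ⁻¹) _)
      (∑-cong λ p → cong (λ z → h (x ⁻¹ ∙ p) * h z) (inv-cancel x y p)))

    ∑-autocorr : (h : Fin n → ℕ) → ∑ (autocorr h) ≡ ∑ h * ∑ h
    ∑-autocorr h = begin
      ∑ (λ g → ∑ λ p → h p * h (g ⁻¹ ∙ p))  ≡⟨ ∑-comm (λ g p → h p * h (g ⁻¹ ∙ p)) ⟩
      ∑ (λ p → ∑ λ g → h p * h (g ⁻¹ ∙ p))  ≡⟨ ∑-cong (λ p → ∑-*ˡ (h p) _) ⟩
      ∑ (λ p → h p * ∑ λ g → h (g ⁻¹ ∙ p))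
        ≡⟨ ∑-cong (λ p → cong (h p *_) (trans (∑-translateʳ p h) (∑-inv (λ g → h (g ∙ p))))) ⟨
      ∑ (λ p → h p * ∑ h)                   ≡⟨ ∑-*ʳ (∑ h) h ⟩
      ∑ h * ∑ h                             ∎
      where open ≡-Reasoning

    autocorr-inv : (h : Fin n → ℕ) (g : Fin n) → autocorr h (g ⁻¹) ≡ autocorr h g
    autocorr-inv h g = trans (∑-translateˡ (g ⁻¹) _) (∑-cong λ p →
      trans (*-comm (h (g ⁻¹ ∙ p)) _)
        (cong (λ z → h z * h (g ⁻¹ ∙ p))
          (trans (cong (_∙ (g ⁻¹ ∙ p)) (⁻¹-involutive g)) (\\-leftDividesˡ g p))))

    autocorr-ε : (A : Subset n) → autocorr (χ A) ε ≡ ∣ A ∣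
    autocorr-ε A = trans
      (∑-cong λ p → trans (cong (λ z → χ A p * χ A z) (trans (cong (_∙ p) ε⁻¹≈ε) (identityˡ p))) (𝟙² (lookup A p)))
      (sym (card A))

    autocorr≤ : (A : Subset n) (g : Fin n) → autocorr (χ A) g ≤ ∣ A ∣
    autocorr≤ A g = ≤-trans
      (∑-mono λ p → x*χ≤x A (g ⁻¹ ∙ p) (χ A p))
      (≤-reflexive (sym (card A)))

    -- The popularity threshold is the fraction C/m, with the denominator moved to the other side.
    Popular? : (A : Subset n) (m C : ℕ) (g : Fin n) → Dec (C ≤ m * autocorr (χ A) g)
    Popular? A m C g = C ≤? m * autocorr (χ A) g

    Pop : Subset n → ℕ → ℕ → Subset n
    Pop A m C = setOf (Popular? A m C)

    -- Markov's inequality: the autocorrelation of A has total mass |A|².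
    ∣Pop∣≤ : (A : Subset n) (m C : ℕ) → ∣ Pop A m C ∣ * C ≤ m * (∣ A ∣ * ∣ A ∣)
    ∣Pop∣≤ A m C = begin
      ∣ P ∣ * C                         ≡⟨ cong (_* C) (card P) ⟩
      ∑ (χ P) * C                       ≡⟨ ∑-*ʳ C (χ P) ⟨
      ∑ (λ g → χ P g * C)               ≤⟨ ∑-mono (λ g → ≤-trans
        (χ-guard P g (∈-setOf⁻ (Popular? A m C))) (χ*x≤x P g (m * autocorr (χ A) g))) ⟩
      ∑ (λ g → m * autocorr (χ A) g)    ≡⟨ ∑-*ˡ m _ ⟩
      m * ∑ (autocorr (χ A))            ≡⟨ cong (m *_) (∑-autocorr (χ A)) ⟩
      m * (∑ (χ A) * ∑ (χ A))           ≡⟨ cong (λ c → m * (c * c)) (card A) ⟨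
      m * (∣ A ∣ * ∣ A ∣)               ∎
      where
      open ≤-Reasoning
      P = Pop A m C

    -- Double counting of the pairs (t , w) ∈ S × W: the sum counts the factorisations y = t w.
    product-count : (S W Y : Subset n) (m C : ℕ) →
      (∀ {y} → y ∈ Y → C ≤ m * ∑ (λ t → χ S t * χ W (t ⁻¹ ∙ y))) →
      ∣ Y ∣ * C ≤ m * (∣ S ∣ * ∣ W ∣)
    product-count S W Y m C h = begin
      ∣ Y ∣ * C                         ≡⟨ cong (_* C) (card Y) ⟩
      ∑ (χ Y) * C                       ≡⟨ ∑-*ʳ C (χ Y) ⟨
      ∑ (λ g → χ Y g * C)               ≤⟨ ∑-mono (λ g → ≤-trans
        (χ-guard Y g h) (χ*x≤x Y g _)) ⟩
      ∑ (λ y → m * ∑ (λ t → χ S t * χ W (t ⁻¹ ∙ y)))  ≡⟨ ∑-*ˡ m _ ⟩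
      m * ∑ (λ y → ∑ (λ t → χ S t * χ W (t ⁻¹ ∙ y)))
        ≡⟨ cong (m *_) (∑-comm (λ y t → χ S t * χ W (t ⁻¹ ∙ y))) ⟩
      m * ∑ (λ t → ∑ (λ y → χ S t * χ W (t ⁻¹ ∙ y)))
        ≡⟨ cong (m *_) (∑-cong λ t → trans (∑-*ˡ (χ S t) _)
             (cong (χ S t *_) (sym (∑-translateˡ (t ⁻¹) (χ W))))) ⟩
      m * ∑ (λ t → χ S t * ∑ (χ W))     ≡⟨ cong (m *_) (∑-*ʳ (∑ (χ W)) (χ S)) ⟩
      m * (∑ (χ S) * ∑ (χ W))           ≡⟨ cong₂ (λ c d → m * (c * d)) (card S) (card W) ⟨
      m * (∣ S ∣ * ∣ W ∣)               ∎
      where open ≤-Reasoning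

    -- For f = χ A and h = χ B this is the indicator of A ∩ pB⁻¹.
    fibre : (f h : Fin n → ℕ) (p : Fin n) → Fin n → ℕ
    fibre f h p x = f x * h (x ⁻¹ ∙ p)

    -- For an indicator f this adds up φ over the quotients of all pairs in the set. With φ the
    -- autocorrelation of B it is the energy; with φ = `co D` it counts the pairs with unpopular
    -- quotient.
    pairs : (Fin n → ℕ) → (Fin n → ℕ) → ℕ
    pairs f φ = ∑ λ x → ∑ λ c → f x * f c * φ (x ⁻¹ ∙ c)

    -- For indicators, a pair (x,c) of the first set lies in the fibre over p for exactly
    -- `autocorr h (x⁻¹ ∙ c)` values of p. The weight 1 turns this into the second moment of the
    -- fibre sizes, the weight `co D` into the total number of bad pairs.
    weighted-energy : (f h φ : Fin n → ℕ) →
      ∑ (λ p → pairs (fibre f h p) φ) ≡ pairs f (λ g → φ g * autocorr h g)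
    weighted-energy f h φ = begin
      ∑ (λ p → ∑ λ x → ∑ λ c → F x c p)  ≡⟨ ∑-comm (λ p x → ∑ λ c → F x c p) ⟩
      ∑ (λ x → ∑ λ p → ∑ λ c → F x c p)  ≡⟨ ∑-cong (λ x → ∑-comm (λ p c → F x c p)) ⟩
      ∑ (λ x → ∑ λ c → ∑ λ p → F x c p)  ≡⟨ ∑-cong (λ x → ∑-cong λ c → inner x c) ⟩
      pairs f (λ g → φ g * autocorr h g) ∎
      where
      open ≡-Reasoning
      F : Fin n → Fin n → Fin n → ℕ
      F x c p = fibre f h p x * fibre f h p c * φ (x ⁻¹ ∙ c)
      inner : ∀ x c → ∑ (F x c) ≡ f x * f c * (φ (x ⁻¹ ∙ c) * autocorr h (x ⁻¹ ∙ c))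
      inner x c = begin
        ∑ (F x c)
          ≡⟨ ∑-cong (λ p → solve 5 (λ a b d e w → a :* b :* (d :* e) :* w := a :* d :* w :* (b :* e)) refl
               (f x) (h (x ⁻¹ ∙ p)) (f c) (h (c ⁻¹ ∙ p)) (φ (x ⁻¹ ∙ c))) ⟩
        ∑ (λ p → f x * f c * φ (x ⁻¹ ∙ c) * (h (x ⁻¹ ∙ p) * h (c ⁻¹ ∙ p)))
          ≡⟨ ∑-*ˡ (f x * f c * φ (x ⁻¹ ∙ c)) _ ⟩
        f x * f c * φ (x ⁻¹ ∙ c) * ∑ (λ p → h (x ⁻¹ ∙ p) * h (c ⁻¹ ∙ p))
          ≡⟨ cong (f x * f c * φ (x ⁻¹ ∙ c) *_) (autocorr-shift h x c) ⟩
        f x * f c * φ (x ⁻¹ ∙ c) * autocorr h (x ⁻¹ ∙ c)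
          ≡⟨ *-assoc (f x * f c) _ _ ⟩
        f x * f c * (φ (x ⁻¹ ∙ c) * autocorr h (x ⁻¹ ∙ c)) ∎

    pairs-const : (f : Fin n → ℕ) (c : ℕ) → pairs f (λ _ → c) ≡ c * (∑ f * ∑ f)
    pairs-const f c = begin
      ∑ (λ x → ∑ λ y → f x * f y * c)  ≡⟨ ∑-cong (λ x → ∑-*ʳ c _) ⟩
      ∑ (λ x → (∑ λ y → f x * f y) * c) ≡⟨ ∑-*ʳ c _ ⟩
      ∑ (λ x → ∑ λ y → f x * f y) * c  ≡⟨ cong (_* c) (∑-*-∑ f f) ⟨
      ∑ f * ∑ f * c                    ≡⟨ *-comm _ c ⟩
      c * (∑ f * ∑ f)                  ∎
      where open ≡-Reasoning

    pairs-mono : (f : Fin n → ℕ) {φ ψ : Fin n → ℕ} → (∀ g → φ g ≤ ψ g) → pairs f φ ≤ pairs f ψ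
    pairs-mono f φ≤ψ = ∑-mono λ x → ∑-mono λ c → *-monoʳ-≤ (f x * f c) (φ≤ψ (x ⁻¹ ∙ c))

    pairs-*ˡ : (f : Fin n → ℕ) (c : ℕ) (φ : Fin n → ℕ) → pairs f (λ g → c * φ g) ≡ c * pairs f φ
    pairs-*ˡ f c φ = trans
      (∑-cong λ x → trans
        (∑-cong λ y → solve 4 (λ a b d e → a :* b :* (d :* e) := d :* (a :* b :* e)) refl
          (f x) (f y) c (φ (x ⁻¹ ∙ y)))
                          (∑-*ˡ c _))
      (∑-*ˡ c _)

    pairs-+ : (f φ ψ : Fin n → ℕ) → pairs f (λ g → φ g + ψ g) ≡ pairs f φ + pairs f ψ
    pairs-+ f φ ψ = trans
      (∑-cong λ x → trans (∑-cong λ y → *-distribˡ-+ (f x * f y) (φ (x ⁻¹ ∙ y)) (ψ (x ⁻¹ ∙ y)))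
                          (∑-+ _ _))
      (∑-+ _ _)

    ∑-fibre : (f h : Fin n → ℕ) → ∑ (λ p → ∑ (fibre f h p)) ≡ ∑ f * ∑ h
    ∑-fibre f h = trans (∑-comm (λ p x → f x * h (x ⁻¹ ∙ p)))
      (trans (∑-cong λ x → trans (∑-*ˡ (f x) _) (cong (f x *_) (sym (∑-translateˡ (x ⁻¹) h))))
             (∑-*ʳ (∑ h) f))

    ∑-fibre² : (f h : Fin n → ℕ) →
      ∑ (λ p → ∑ (fibre f h p) * ∑ (fibre f h p)) ≡ pairs f (autocorr h)
    ∑-fibre² f h = begin
      ∑ (λ p → ∑ (fibre f h p) * ∑ (fibre f h p))
        ≡⟨ ∑-cong (λ p → trans (pairs-const (fibre f h p) 1) (*-identityˡ _)) ⟨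
      ∑ (λ p → pairs (fibre f h p) (λ _ → 1))
        ≡⟨ weighted-energy f h (λ _ → 1) ⟩
      pairs f (λ g → 1 * autocorr h g)
        ≡⟨ trans (pairs-*ˡ f 1 (autocorr h)) (*-identityˡ _) ⟩
      pairs f (autocorr h) ∎
      where open ≡-Reasoning

    -- The equation a₁b₁ = a₂b₂ determines b₂ as (a₁⁻¹a₂)⁻¹b₁, so the innermost sum collapses to one
    -- indicator and the sum over b₁ is an autocorrelation of B.
    energy≡pairs : (A B : Subset n) → energy G A B ≡ pairs (χ A) (autocorr (χ B))
    energy≡pairs A B = Σfin-cong λ a₁ → Σfin-cong λ a₂ →
      trans (Σfin-cong λ b₁ → Σfin≡∑ (e a₁ a₂ b₁)) (inner a₁ a₂)
      where
      open ≡-Reasoning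
      e : Fin n → Fin n → Fin n → Fin n → ℕ
      e a₁ a₂ b₁ b₂ =
        𝟙 (lookup A a₁ ∧ lookup A a₂ ∧ lookup B b₁ ∧ lookup B b₂ ∧ ⌊ (a₁ ∙ b₁) ≟ (a₂ ∙ b₂) ⌋)
      term : ∀ a₁ a₂ b₁ b₂ → e a₁ a₂ b₁ b₂ ≡
        χ A a₁ * χ A a₂ * (χ B b₁ * (χ B b₂ * 𝟙 ⌊ (a₁ ∙ b₁) ≟ (a₂ ∙ b₂) ⌋))
      term a₁ a₂ b₁ b₂ with lookup A a₁ | lookup A a₂ | lookup B b₁
      ... | false | _ | _ = refl
      ... | true | false | _ = refl
      ... | true | true | false = refl
      ... | true | true | true =
        trans (𝟙-∧ (lookup B b₂) _) (sym (trans (+-identityʳ _) (+-identityʳ _)))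
      δ : ∀ a₁ a₂ b₁ → ∑ (λ b₂ → χ B b₂ * 𝟙 ⌊ (a₁ ∙ b₁) ≟ (a₂ ∙ b₂) ⌋) ≡ χ B ((a₁ ⁻¹ ∙ a₂) ⁻¹ ∙ b₁)
      δ a₁ a₂ b₁ = begin
        ∑ (λ b₂ → χ B b₂ * 𝟙 ⌊ (a₁ ∙ b₁) ≟ (a₂ ∙ b₂) ⌋)
          ≡⟨ ∑-cong (λ b₂ → cong (λ z → χ B z * 𝟙 ⌊ (a₁ ∙ b₁) ≟ (a₂ ∙ b₂) ⌋) (sym (\\-leftDividesʳ a₂ b₂))) ⟩
        ∑ (λ b₂ → χ B (a₂ ⁻¹ ∙ (a₂ ∙ b₂)) * 𝟙 ⌊ (a₁ ∙ b₁) ≟ (a₂ ∙ b₂) ⌋)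
          ≡⟨ ∑-translateˡ a₂ (λ z → χ B (a₂ ⁻¹ ∙ z) * 𝟙 ⌊ (a₁ ∙ b₁) ≟ z ⌋) ⟨
        ∑ (λ z → χ B (a₂ ⁻¹ ∙ z) * 𝟙 ⌊ (a₁ ∙ b₁) ≟ z ⌋)
          ≡⟨ ∑-δ (a₁ ∙ b₁) (λ z → χ B (a₂ ⁻¹ ∙ z)) ⟩
        χ B (a₂ ⁻¹ ∙ (a₁ ∙ b₁))
          ≡⟨ cong (χ B) (trans (sym (assoc _ _ _)) (cong (_∙ b₁) (sym (⁻¹-anti-homo-\\ a₁ a₂)))) ⟩
        χ B ((a₁ ⁻¹ ∙ a₂) ⁻¹ ∙ b₁) ∎
      inner : ∀ a₁ a₂ →
        ∑ (λ b₁ → ∑ (e a₁ a₂ b₁)) ≡ χ A a₁ * χ A a₂ * autocorr (χ B) (a₁ ⁻¹ ∙ a₂)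
      inner a₁ a₂ = begin
        _ ≡⟨ ∑-cong (λ b₁ → trans (∑-cong (term a₁ a₂ b₁))
               (trans (∑-*ˡ (χ A a₁ * χ A a₂) (λ b₂ → χ B b₁ * (χ B b₂ * 𝟙 ⌊ (a₁ ∙ b₁) ≟ (a₂ ∙ b₂) ⌋)))
                 (cong (χ A a₁ * χ A a₂ *_)
                   (trans (∑-*ˡ (χ B b₁) (λ b₂ → χ B b₂ * 𝟙 ⌊ (a₁ ∙ b₁) ≟ (a₂ ∙ b₂) ⌋))
                     (cong (χ B b₁ *_) (δ a₁ a₂ b₁)))))) ⟩
        ∑ (λ b₁ → χ A a₁ * χ A a₂ * (χ B b₁ * χ B ((a₁ ⁻¹ ∙ a₂) ⁻¹ ∙ b₁)))
          ≡⟨ ∑-*ˡ (χ A a₁ * χ A a₂) _ ⟩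
        χ A a₁ * χ A a₂ * autocorr (χ B) (a₁ ⁻¹ ∙ a₂) ∎

  -- The Balog-Szemerédi-Gowers argument: a dense fibre and its refinement.

  co : Subset n → Fin n → ℕ
  co D g = 𝟙 (not (lookup D g))

  module BSG {n : ℕ} (G : FinGroup n) where
    open GroupCounting G

    fibreSet : Subset n → Subset n → Fin n → Subset n
    fibreSet A B p = tabulate λ x → lookup A x ∧ lookup B (x ⁻¹ ∙ p)

    χ-fibreSet : ∀ A B p x → χ (fibreSet A B p) x ≡ fibre (χ A) (χ B) p x
    χ-fibreSet A B p x = trans
      (cong 𝟙 (lookup∘tabulate (λ x → lookup A x ∧ lookup B (x ⁻¹ ∙ p)) x))
      (𝟙-∧ (lookup A x) _)

    pairs-cong : ∀ {f f′ : Fin n → ℕ} (φ : Fin n → ℕ) → (∀ i → f i ≡ f′ i) → pairs f φ ≡ pairs f′ φ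
    pairs-cong φ f≡ = ∑-cong λ x → ∑-cong λ c → cong (_* φ (x ⁻¹ ∙ c)) (cong₂ _*_ (f≡ x) (f≡ c))

    -- Both conclusions follow from the single inequality E·N(p) + 64ab·bad(p) < 4ab·N(p)². Summed
    -- over p, its right side is 4abE since ∑N² = E, while its left side is at most 2abE since ∑N =
    -- ab and ∑bad ≤ E/64. The threshold E/64a² for D is chosen to give this last bound.
    dense-fibre : (A B : Subset n) →
      let a = ∣ A ∣; b = ∣ B ∣; E = pairs (χ A) (autocorr (χ B)) in
      0 < a → 0 < b → 0 < E →
      ∃ λ p → let P = fibreSet A B p in
        E < 4 * (a * b) * ∣ P ∣ ×
        16 * pairs (χ P) (co (Pop B (64 * (a * a)) E)) < ∣ P ∣ * ∣ P ∣
    dense-fibre A B a>0 b>0 E>0 = p , E<4abN , 16bad<N²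
      where
      a = ∣ A ∣
      b = ∣ B ∣
      E = pairs (χ A) (autocorr (χ B))
      D = Pop B (64 * (a * a)) E
      N : Fin n → ℕ
      N p = ∑ (fibre (χ A) (χ B) p)
      bad : Fin n → ℕ
      bad p = pairs (fibre (χ A) (χ B) p) (co D)

      unpopular : ∀ g → 64 * (a * a) * (co D g * autocorr (χ B) g) ≤ E
      unpopular g with lookup D g in eq
      ... | true = ≤-trans (≤-reflexive (*-zeroʳ (64 * (a * a)))) z≤n
      ... | false rewrite +-identityʳ (autocorr (χ B) g) = ≰⇒≥ λ E≤ →
        contradiction (trans (sym eq) ([]=⇒lookup (∈-setOf⁺ (Popular? B (64 * (a * a)) E) E≤))) λ ()

      -- There are at most a² pairs in A² with unpopular quotient, and each lies in at most E/64a²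
      -- fibres.
      64∑bad≤E : 64 * ∑ bad ≤ E
      64∑bad≤E = cancelˡ-≤ (*-pos a>0 a>0) $ begin
        a * a * (64 * ∑ bad)
          ≡⟨ solve 2 (λ a s → a :* (con 64 :* s) := con 64 :* a :* s) refl (a * a) (∑ bad) ⟩
        64 * (a * a) * ∑ bad
          ≡⟨ cong (64 * (a * a) *_) (weighted-energy (χ A) (χ B) (co D)) ⟩
        64 * (a * a) * pairs (χ A) (λ g → co D g * autocorr (χ B) g)
          ≡⟨ pairs-*ˡ (χ A) (64 * (a * a)) (λ g → co D g * autocorr (χ B) g) ⟨
        pairs (χ A) (λ g → 64 * (a * a) * (co D g * autocorr (χ B) g))
          ≤⟨ pairs-mono (χ A) {φ = λ g → 64 * (a * a) * (co D g * autocorr (χ B) g)} unpopular ⟩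
        pairs (χ A) (λ _ → E)
          ≡⟨ pairs-const (χ A) E ⟩
        E * (∑ (χ A) * ∑ (χ A))
          ≡⟨ trans (cong (λ c → E * (c * c)) (sym (card A))) (*-comm E _) ⟩
        a * a * E ∎
        where open ≤-Reasoning

      -- Rules out, on average over p, both N p ≤ E / 4ab and bad p ≥ (N p)² / 16.
      average : ∑ (λ p → E * N p + 64 * (a * b) * bad p) < ∑ (λ p → 4 * (a * b) * (N p * N p))
      average = begin-strict
        ∑ (λ p → E * N p + 64 * (a * b) * bad p)
          ≡⟨ trans (∑-+ _ _) (cong₂ _+_ (∑-*ˡ E N) (∑-*ˡ (64 * (a * b)) bad)) ⟩
        E * ∑ N + 64 * (a * b) * ∑ bad
          ≡⟨ cong₂ _+_ (cong (E *_) (trans (∑-fibre (χ A) (χ B)) (cong₂ _*_ (sym (card A)) (sym (card B)))))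
                       (solve 2 (λ c s → con 64 :* c :* s := c :* (con 64 :* s)) refl (a * b) (∑ bad)) ⟩
        E * (a * b) + a * b * (64 * ∑ bad)
          ≤⟨ +-monoʳ-≤ (E * (a * b)) (*-monoʳ-≤ (a * b) 64∑bad≤E) ⟩
        E * (a * b) + a * b * E
          <⟨ m<m+n _ (*-pos (*-pos a>0 b>0) E>0) ⟩
        E * (a * b) + a * b * E + a * b * E
          ≤⟨ m≤m+n _ (a * b * E) ⟩
        E * (a * b) + a * b * E + a * b * E + a * b * E
          ≡⟨ solve 2 (λ c e → e :* c :+ c :* e :+ c :* e :+ c :* e := con 4 :* c :* e) refl (a * b) E ⟩
        4 * (a * b) * E
          ≡⟨ cong (4 * (a * b) *_) (∑-fibre² (χ A) (χ B)) ⟨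
        4 * (a * b) * ∑ (λ p → N p * N p)
          ≡⟨ ∑-*ˡ (4 * (a * b)) _ ⟨
        ∑ (λ p → 4 * (a * b) * (N p * N p)) ∎
        where open ≤-Reasoning

      chosen = ∑-<⇒∃ average
      p = proj₁ chosen
      P = fibreSet A B p

      ∣P∣ : ∣ P ∣ ≡ N p
      ∣P∣ = trans (card P) (∑-cong (χ-fibreSet A B p))

      E<4abN : E < 4 * (a * b) * ∣ P ∣
      E<4abN = *-cancelʳ-< (N p) E (4 * (a * b) * ∣ P ∣) $ begin-strict
        E * N p                   ≤⟨ m≤m+n _ _ ⟩
        E * N p + _               <⟨ proj₂ chosen ⟩
        4 * (a * b) * (N p * N p) ≡⟨ *-assoc (4 * (a * b)) (N p) (N p) ⟨
        4 * (a * b) * N p * N p   ≡⟨ cong (λ c → 4 * (a * b) * c * N p) ∣P∣ ⟨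
        4 * (a * b) * ∣ P ∣ * N p ∎
        where open ≤-Reasoning

      16bad<N² : 16 * pairs (χ P) (co D) < ∣ P ∣ * ∣ P ∣
      16bad<N² = *-cancelˡ-< (4 * (a * b)) _ _ $ begin-strict
        4 * (a * b) * (16 * pairs (χ P) (co D))
          ≡⟨ cong (λ c → 4 * (a * b) * (16 * c)) (pairs-cong (co D) (χ-fibreSet A B p)) ⟩
        4 * (a * b) * (16 * bad p)
          ≡⟨ solve 2 (λ c s → con 4 :* c :* (con 16 :* s) := con 64 :* c :* s) refl (a * b) (bad p) ⟩
        64 * (a * b) * bad p      ≤⟨ m≤n+m _ _ ⟩
        E * N p + 64 * (a * b) * bad p <⟨ proj₂ chosen ⟩
        4 * (a * b) * (N p * N p) ≡⟨ cong (λ c → 4 * (a * b) * (c * c)) ∣P∣ ⟨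
        4 * (a * b) * (∣ P ∣ * ∣ P ∣) ∎
        where open ≤-Reasoning

    -- At most N²/16 bad pairs leave at most N/4 elements with more than N/4 bad partners, so |X| ≥
    -- 3N/4, weakened to N/2 to keep powers of 2. For x, y ∈ X at most N/4 elements c ∈ P are bad
    -- for either, so at least N/2 are good for both; each gives x⁻¹y = (x⁻¹c)(y⁻¹c)⁻¹ with both
    -- x⁻¹c and y⁻¹c in D.
    refine : (P D : Subset n) → 0 < ∣ P ∣ → 16 * pairs (χ P) (co D) ≤ ∣ P ∣ * ∣ P ∣ →
      ∃ λ X → X ⊆ P × ∣ P ∣ ≤ 2 * ∣ X ∣ ×
        (∀ {x y} → x ∈ X → y ∈ X → ∣ P ∣ ≤ 2 * autocorr (χ D) (x ⁻¹ ∙ y))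
    refine P D N>0 few = X , proj₁ ∘ ∈-setOf⁻ X? , N≤2∣X∣ , paths
      where
      N = ∣ P ∣
      bad : Fin n → ℕ
      bad x = ∑ λ c → χ P c * co D (x ⁻¹ ∙ c)
      X? : ∀ x → Dec (x ∈ P × 4 * bad x ≤ N)
      X? x = x ∈? P ×-dec 4 * bad x ≤? N
      X = setOf X?

      -- Markov's inequality, written so that summing over x bounds ∣ X ∣ from below.
      markov : ∀ x → χ P x * N ≤ χ X x * N + 4 * (χ P x * bad x)
      markov x = begin
        χ P x * N                              ≤⟨ χ-guard P x one-of ⟩
        χ P x * (χ X x * N + 4 * bad x)
          ≡⟨ solve 3 (λ p u v → p :* (u :+ con 4 :* v) := p :* u :+ con 4 :* (p :* v)) refl (χ P x) (χ X x * N) (bad x) ⟩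
        χ P x * (χ X x * N) + 4 * (χ P x * bad x)
          ≤⟨ +-monoˡ-≤ _ (χ*x≤x P x (χ X x * N)) ⟩
        χ X x * N + 4 * (χ P x * bad x)        ∎
        where
        open ≤-Reasoning
        one-of : x ∈ P → N ≤ χ X x * N + 4 * bad x
        one-of x∈P with 4 * bad x ≤? N
        ... | yes q = ≤-trans 
          (≤-reflexive (sym (trans (cong (_* N) (χ-∈ (∈-setOf⁺ X? (x∈P , q)))) (*-identityˡ N))))
          (m≤m+n _ (4 * bad x))
        ... | no ¬q = ≤-trans (≰⇒≥ ¬q) (m≤n+m _ (χ X x * N))

      pairs≡ : ∑ (λ x → χ P x * bad x) ≡ pairs (χ P) (co D)
      pairs≡ = ∑-cong λ x → trans (sym (∑-*ˡ (χ P x) _)) (∑-cong λ c → sym (*-assoc (χ P x) _ _))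

      N²≤ : N * N ≤ ∣ X ∣ * N + 4 * pairs (χ P) (co D)
      N²≤ = begin
        N * N                                  ≡⟨ trans (∑-*ʳ N (χ P)) (cong (_* N) (sym (card P))) ⟨
        ∑ (λ x → χ P x * N)                    ≤⟨ ∑-mono markov ⟩
        ∑ (λ x → χ X x * N + 4 * (χ P x * bad x))
          ≡⟨ trans (∑-+ _ _) (cong₂ _+_ (∑-*ʳ N (χ X)) (∑-*ˡ 4 _)) ⟩
        ∑ (χ X) * N + 4 * ∑ (λ x → χ P x * bad x)
          ≡⟨ cong₂ (λ c d → c * N + 4 * d) (card X) (sym pairs≡) ⟨
        ∣ X ∣ * N + 4 * pairs (χ P) (co D)     ∎
        where open ≤-Reasoning

      N≤2∣X∣ : N ≤ 2 * ∣ X ∣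
      N≤2∣X∣ = cancelˡ-≤ {2 * N} (*-pos {2} (s≤s z≤n) N>0) $ +-cancelˡ-≤ (N * N + N * N) _ _ $ begin
        N * N + N * N + 2 * N * N
          ≡⟨ solve 1 (λ n → n :* n :+ n :* n :+ con 2 :* n :* n := con 4 :* (n :* n)) refl N ⟩
        4 * (N * N)                                ≤⟨ *-monoʳ-≤ 4 N²≤ ⟩
        4 * (∣ X ∣ * N + 4 * w)
          ≡⟨ solve 3 (λ x n w → con 4 :* (x :* n :+ con 4 :* w) := con 16 :* w :+ con 2 :* n :* (con 2 :* x)) refl (∣ X ∣) N w ⟩
        16 * w + 2 * N * (2 * ∣ X ∣)               ≤⟨ +-monoˡ-≤ _ (≤-trans few (m≤m+n (N * N) (N * N))) ⟩
        N * N + N * N + 2 * N * (2 * ∣ X ∣)        ∎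
        where
        open ≤-Reasoning
        w = pairs (χ P) (co D)

      paths : ∀ {x y} → x ∈ X → y ∈ X → N ≤ 2 * autocorr (χ D) (x ⁻¹ ∙ y)
      paths {x} {y} x∈X y∈X = cancelˡ-≤ {2} (s≤s z≤n) $ +-cancelˡ-≤ (N + N) _ _ $ begin
        N + N + 2 * N
          ≡⟨ solve 1 (λ n → n :+ n :+ con 2 :* n := con 4 :* n) refl N ⟩
        4 * N                                      ≤⟨ *-monoʳ-≤ 4 split ⟩
        4 * (bad x + bad y + r)
          ≡⟨ solve 3 (λ u v r → con 4 :* (u :+ v :+ r) := con 4 :* u :+ con 4 :* v :+ con 2 :* (con 2 :* r)) refl
            (bad x) (bad y) r ⟩
        4 * bad x + 4 * bad y + 2 * (2 * r)
          ≤⟨ +-monoˡ-≤ _ (+-mono-≤ (proj₂ (∈-setOf⁻ X? x∈X)) (proj₂ (∈-setOf⁻ X? y∈X))) ⟩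
        N + N + 2 * (2 * r)                        ∎
        where
        open ≤-Reasoning
        r = autocorr (χ D) (x ⁻¹ ∙ y)
        cases : ∀ p u v → 𝟙 p ≤ 𝟙 p * 𝟙 (not u) + 𝟙 p * 𝟙 (not v) + 𝟙 u * 𝟙 v
        cases false u v = z≤n
        cases true false v = s≤s z≤n
        cases true true false = s≤s z≤n
        cases true true true = s≤s z≤n
        split : N ≤ bad x + bad y + r
        split = begin
          N                                        ≡⟨ card P ⟩
          ∑ (χ P)
            ≤⟨ ∑-mono (λ c → cases (lookup P c) (lookup D (x ⁻¹ ∙ c)) (lookup D (y ⁻¹ ∙ c))) ⟩
          ∑ (λ c → χ P c * co D (x ⁻¹ ∙ c) + χ P c * co D (y ⁻¹ ∙ c) + χ D (x ⁻¹ ∙ c) * χ D (y ⁻¹ ∙ c))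
            ≡⟨ trans (∑-+ _ _) (cong₂ _+_ (∑-+ _ _) (autocorr-shift (χ D) x y)) ⟩
          bad x + bad y + r                        ∎

  -- Product sets, powers, and Ruzsa's covering lemma.

  module Sets {n : ℕ} (G : FinGroup n) where
    open GroupCounting G
    open BSG G

    infixl 8 _·_
    opaque
      _·_ : Subset n → Subset n → Subset n
      _·_ = prodSet G

      ∈-·⁺ : ∀ {A B a b} → a ∈ A → b ∈ B → a ∙ b ∈ A · B
      ∈-·⁺ {a = a} {b} a∈A b∈B = ∈-tabulate⁺ _ $ to T-≡ $
        any⁺ _ $ List.lose (∈-allFin a) $
        any⁺ _ $ List.lose (∈-allFin b) $
        from T-∧ (from T-≡ ([]=⇒lookup a∈A) ,
          from T-∧ (from T-≡ ([]=⇒lookup b∈B) , fromWitness refl))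

      ∈-·⁻ : ∀ {A B g} → g ∈ A · B → ∃₂ λ a b → a ∈ A × b ∈ B × a ∙ b ≡ g
      ∈-·⁻ {A} {B} g∈
        with a , p ← satisfied (any⁻ _ (allFin n) (from T-≡ (∈-tabulate⁻ _ g∈)))
        with b , q ← satisfied (any⁻ _ (allFin n) p)
        with a∈ , q′ ← to T-∧ q
        with b∈ , eq ← to T-∧ q′
        = a , b , lookup⇒[]= a A (to T-≡ a∈) , lookup⇒[]= b B (to T-≡ b∈) , toWitness eq

    ∈-inv⁺ : ∀ {A g} → g ⁻¹ ∈ A → g ∈ invSet G A
    ∈-inv⁺ {A} p = ∈-tabulate⁺ (λ g → lookup A (g ⁻¹)) ([]=⇒lookup p)

    ∈-inv⁻ : ∀ {A g} → g ∈ invSet G A → g ⁻¹ ∈ A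
    ∈-inv⁻ {A} p = lookup⇒[]= _ A (∈-tabulate⁻ (λ g → lookup A (g ⁻¹)) p)

    ∣inv∣ : ∀ A → ∣ invSet G A ∣ ≡ ∣ A ∣
    ∣inv∣ A = trans (card (invSet G A)) (trans (∑-cong λ i → cong 𝟙 (lookup∘tabulate (λ g → lookup A (g ⁻¹)) i))
      (trans (sym (∑-inv (χ A))) (sym (card A))))

    -- This is d⁻¹Ad, given as a preimage so that membership needs no witness.
    conj : Fin n → Subset n → Subset n
    conj d A = tabulate λ g → lookup A (d ∙ g ∙ d ⁻¹)

    ∈-conj⁺ : ∀ {d A g} → d ∙ g ∙ d ⁻¹ ∈ A → g ∈ conj d A
    ∈-conj⁺ {d} {A} p = ∈-tabulate⁺ (λ g → lookup A (d ∙ g ∙ d ⁻¹)) ([]=⇒lookup p)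

    ∈-conj⁻ : ∀ {d A g} → g ∈ conj d A → d ∙ g ∙ d ⁻¹ ∈ A
    ∈-conj⁻ {d} {A} p = lookup⇒[]= _ A (∈-tabulate⁻ (λ g → lookup A (d ∙ g ∙ d ⁻¹)) p)

    ∣conj∣ : ∀ d A → ∣ conj d A ∣ ≡ ∣ A ∣
    ∣conj∣ d A = begin
      ∣ conj d A ∣                     ≡⟨ card (conj d A) ⟩
      ∑ (χ (conj d A))
        ≡⟨ ∑-cong (λ g → cong 𝟙 (lookup∘tabulate (λ g → lookup A (d ∙ g ∙ d ⁻¹)) g)) ⟩
      ∑ (λ g → χ A (d ∙ g ∙ d ⁻¹))     ≡⟨ ∑-translateˡ d (λ g → χ A (g ∙ d ⁻¹)) ⟨
      ∑ (λ g → χ A (g ∙ d ⁻¹))         ≡⟨ ∑-translateʳ (d ⁻¹) (χ A) ⟨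
      ∑ (χ A)                          ≡⟨ card A ⟨
      ∣ A ∣                            ∎
      where open ≡-Reasoning

    pow : Subset n → ℕ → Subset n
    pow S zero = ⁅ ε ⁆
    pow S (suc k) = S · pow S k

    module _ {S : Subset n} where

      ∈-pow-+ : ∀ j k {g h} → g ∈ pow S j → h ∈ pow S k → g ∙ h ∈ pow S (j + k)
      ∈-pow-+ zero k {h = h} g∈ h∈ rewrite x∈⁅y⁆⇒x≡y ε g∈ | identityˡ h = h∈
      ∈-pow-+ (suc j) k {h = h} g∈ h∈ with s , w , s∈ , w∈ , refl ← ∈-·⁻ g∈ =
        subst (_∈ pow S (suc j + k)) (sym (assoc s w h)) (∈-·⁺ s∈ (∈-pow-+ j k w∈ h∈))

      ∈-pow-split : ∀ j {k g} → g ∈ pow S (j + k) → ∃₂ λ u v → u ∈ pow S j × v ∈ pow S k × u ∙ v ≡ g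
      ∈-pow-split zero {g = g} g∈ = ε , g , x∈⁅x⁆ ε , g∈ , identityˡ g
      ∈-pow-split (suc j) g∈
        with s , w , s∈ , w∈ , refl ← ∈-·⁻ g∈
        with u , v , u∈ , v∈ , refl ← ∈-pow-split j w∈ =
        s ∙ u , v , ∈-·⁺ s∈ u∈ , v∈ , assoc s u v

      ∈-pow-1 : ∀ {s} → s ∈ S → s ∈ pow S 1
      ∈-pow-1 {s} s∈ = subst (_∈ pow S 1) (identityʳ s) (∈-·⁺ s∈ (x∈⁅x⁆ ε))

      module _ (inv-closed : ∀ {s} → s ∈ S → s ⁻¹ ∈ S) where

        ∈-pow-inv : ∀ k {g} → g ∈ pow S k → g ⁻¹ ∈ pow S k
        ∈-pow-inv zero g∈ rewrite x∈⁅y⁆⇒x≡y ε g∈ =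
          subst (_∈ ⁅ ε ⁆) (sym ε⁻¹≈ε) (x∈⁅x⁆ ε)
        ∈-pow-inv (suc k) g∈ with s , w , s∈ , w∈ , refl ← ∈-·⁻ g∈ =
          subst₂ (λ h j → h ∈ pow S j) (sym (⁻¹-anti-homo-∙ s w)) (+-comm k 1)
            (∈-pow-+ k 1 (∈-pow-inv k w∈) (∈-pow-1 (inv-closed s∈)))

    -- The translate uS meets CS; equivalently u ∈ C S S⁻¹.
    Meets : Subset n → Subset n → Fin n → Set
    Meets S C u = ∃ λ s → s ∈ S × u ∙ s ∈ C · S

    -- A greedy pass over the group replaces the choice of a maximal family of disjoint translates:
    -- u ∈ U joins C only if uS misses CS, so each addition enlarges CS by at least |S|.
    -- Disjointness is remembered only as the invariant |C||S| ≤ |CS|.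
    ruzsa-covering : (U S : Subset n) → Nonempty S →
      ∃ λ C → C ⊆ U × ∣ C ∣ * ∣ S ∣ ≤ ∣ C · S ∣ × (∀ {u} → u ∈ U → Meets S C u)
    ruzsa-covering U S (s₀ , s₀∈S) = let C , C⊆U , size , cov = go (allFin n) in
      C , C⊆U , size , λ {u} → cov (∈-allFin u)
      where
      grow : (C : Subset n) (u : Fin n) → ¬ Meets S C u → ∣ C ∣ * ∣ S ∣ ≤ ∣ C · S ∣ →
        ∣ C ∪ ⁅ u ⁆ ∣ * ∣ S ∣ ≤ ∣ (C ∪ ⁅ u ⁆) · S ∣
      grow C u disjoint size = begin
        ∣ C ∪ ⁅ u ⁆ ∣ * ∣ S ∣              ≤⟨ *-monoˡ-≤ ∣ S ∣ ∪≤ ⟩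
        (∣ C ∣ + 1) * ∣ S ∣
          ≡⟨ trans (*-distribʳ-+ ∣ S ∣ ∣ C ∣ 1) (cong (∣ C ∣ * ∣ S ∣ +_) (*-identityˡ ∣ S ∣)) ⟩
        ∣ C ∣ * ∣ S ∣ + ∣ S ∣              ≤⟨ +-monoˡ-≤ ∣ S ∣ size ⟩
        ∣ C · S ∣ + ∣ S ∣
          ≡⟨ cong₂ _+_ (card (C · S)) (trans (card S) (∑-translateˡ (u ⁻¹) (χ S))) ⟩
        ∑ (χ (C · S)) + ∑ (λ g → χ S (u ⁻¹ ∙ g)) ≡⟨ ∑-+ _ _ ⟨
        ∑ (λ g → χ (C · S) g + χ S (u ⁻¹ ∙ g))   ≤⟨ ∑-mono pointwise ⟩
        ∑ (χ ((C ∪ ⁅ u ⁆) · S))            ≡⟨ card ((C ∪ ⁅ u ⁆) · S) ⟨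
        ∣ (C ∪ ⁅ u ⁆) · S ∣                ∎
        where
        open ≤-Reasoning
        ∪≤ : ∣ C ∪ ⁅ u ⁆ ∣ ≤ ∣ C ∣ + 1
        ∪≤ = ≤-trans (∣p∪q∣≤∣p∣+∣q∣ C ⁅ u ⁆) (≤-reflexive (cong (∣ C ∣ +_) (∣⁅x⁆∣≡1 u)))
        pointwise : ∀ g → χ (C · S) g + χ S (u ⁻¹ ∙ g) ≤ χ ((C ∪ ⁅ u ⁆) · S) g
        pointwise g with lookup (C · S) g in eq
        ... | false = χ-mono S ((C ∪ ⁅ u ⁆) · S) λ s∈ →
          subst (_∈ (C ∪ ⁅ u ⁆) · S) (\\-leftDividesˡ u g) (∈-·⁺ (q⊆p∪q C ⁅ u ⁆ (x∈⁅x⁆ u)) s∈)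
        ... | true with c , s , c∈ , s∈ , refl ← ∈-·⁻ (lookup⇒[]= g (C · S) eq)
          with lookup S (u ⁻¹ ∙ (c ∙ s)) in eq′
        -- A common point g of CS and uS would exhibit u⁻¹g ∈ S as a meeting of the two.
        ...   | true = contradiction
          (_ , lookup⇒[]= _ S eq′ , subst (_∈ C · S) (sym (\\-leftDividesˡ u (c ∙ s))) (lookup⇒[]= _ (C · S) eq))
          disjoint
        ...   | false = ≤-reflexive (sym (χ-∈ (∈-·⁺ (p⊆p∪q ⁅ u ⁆ c∈) s∈)))

      go : (l : List (Fin n)) →
        ∃ λ C → C ⊆ U × ∣ C ∣ * ∣ S ∣ ≤ ∣ C · S ∣ × (∀ {u} → u List.∈ l → u ∈ U → Meets S C u)
      go [] = ⊥ , (λ p → contradiction p ∉⊥) , ≤-trans (≤-reflexive (cong (_* ∣ S ∣) (∣⊥∣≡0 n))) z≤n , λ ()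
      go (u ∷ l) with go l
      ... | C , C⊆U , size , cov with u ∈? U | any? (λ s → s ∈? S ×-dec (u ∙ s) ∈? (C · S))
      ...   | no u∉U | _ = C , C⊆U , size , λ where
        (here refl) u∈U → contradiction u∈U u∉U
        (there v∈l) → cov v∈l
      ...   | yes _ | yes m = C , C⊆U , size , λ where
        (here refl) _ → m
        (there v∈l) → cov v∈l
      ...   | yes u∈U | no ¬m = C ∪ ⁅ u ⁆
        , (λ v∈ → [ C⊆U , (λ v∈u → subst (_∈ U) (sym (x∈⁅y⁆⇒x≡y u v∈u)) u∈U) ]′ (x∈p∪q⁻ C ⁅ u ⁆ v∈))
        , grow C u ¬m size
        , λ where
          (here refl) _ → s₀ , s₀∈S , ∈-·⁺ (q⊆p∪q C ⁅ u ⁆ (x∈⁅x⁆ u)) s₀∈S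
          (there v∈l) v∈U → let s , s∈ , vs∈ = cov v∈l v∈U
                                c , s′ , c∈ , s′∈ , eq = ∈-·⁻ vs∈
                            in s , s∈ , subst (_∈ (C ∪ ⁅ u ⁆) · S) eq (∈-·⁺ (p⊆p∪q ⁅ u ⁆ c∈) s′∈)

  -- The symmetry set of X and the growth of its powers.

  module Symmetry {n : ℕ} (G : FinGroup n) (X Q : Subset n) (K : ℕ) where
    open GroupCounting G
    open BSG G
    open Sets G

    N : ℕ
    N = ∣ X ∣

    -- Under the hypotheses below, the mean of |X ∩ gX| over g = de⁻¹ with d, e ∈ X is at least
    -- |X|/K (`energy-lower`). Half of that mean is the threshold, so that S retains a positive
    -- proportion of these quotients.
    S : Subset n
    S = Pop X (2 * K) N

    module _ (N>0 : 0 < N) (K>0 : 0 < K)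
             (quotients : ∀ {x y} → x ∈ X → y ∈ X → x ⁻¹ ∙ y ∈ Q) (∣Q∣≤ : ∣ Q ∣ ≤ K * N) where

      S? : ∀ g → Dec (N ≤ 2 * K * autocorr (χ X) g)
      S? = Popular? X (2 * K) N

      ε∈S : ε ∈ S
      ε∈S = ∈-setOf⁺ S? $ begin
        N                             ≤⟨ m≤n*m N (2 * K) {{>-nonZero (*-pos {2} (s≤s z≤n) K>0)}} ⟩
        2 * K * N                     ≡⟨ cong (2 * K *_) (autocorr-ε X) ⟨
        2 * K * autocorr (χ X) ε      ∎
        where open ≤-Reasoning

      S-inv : ∀ {s} → s ∈ S → s ⁻¹ ∈ S
      S-inv {s} s∈ = ∈-setOf⁺ S?
        (subst (λ r → N ≤ 2 * K * r) (sym (autocorr-inv (χ X) s)) (∈-setOf⁻ S? s∈))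

      private
        -- The indicator of X⁻¹: the energy considered is that of X⁻¹ and X, whose products all lie
        -- in the small set Q.
        f : Fin n → ℕ
        f x = χ X (x ⁻¹)

        ∑f : ∑ f ≡ N
        ∑f = trans (sym (∑-inv (χ X))) (sym (card X))

      -- Cauchy-Schwarz for the number q(p) of representations of p in X⁻¹X: the total is N², spread
      -- over at most KN elements of Q.
      energy-lower : N * N * N ≤ K * pairs f (autocorr (χ X))
      energy-lower = cancelˡ-≤ N>0 $ begin
        N * (N * N * N)        ≡⟨ solve 1 (λ n → n :* (n :* n :* n) := n :* n :* (n :* n)) refl N ⟩
        N * N * (N * N)        ≡⟨ cong (λ c → c * c) ∑q ⟨
        ∑ q * ∑ q              ≤⟨ cauchy-schwarz Q q supported ⟩
        ∣ Q ∣ * ∑ (λ p → q p * q p)  ≤⟨ *-monoˡ-≤ _ ∣Q∣≤ ⟩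
        K * N * ∑ (λ p → q p * q p)  ≡⟨ cong (K * N *_) (∑-fibre² f (χ X)) ⟩
        K * N * pairs f (autocorr (χ X))
          ≡⟨ solve 3 (λ k n r → k :* n :* r := n :* (k :* r)) refl K N _ ⟩
        N * (K * pairs f (autocorr (χ X))) ∎
        where
        open ≤-Reasoning
        q : Fin n → ℕ
        q p = ∑ (fibre f (χ X) p)
        ∑q : ∑ q ≡ N * N
        ∑q = trans (∑-fibre f (χ X)) (cong₂ _*_ ∑f (sym (card X)))
        supported : ∀ p → 0 < q p → p ∈ Q
        supported p q>0 =
          let x , pos = ∑-pos q>0
              x⁻¹∈ , x⁻¹p∈ = *-pos⁻ (f x) (χ X (x ⁻¹ ∙ p)) pos
          in subst (_∈ Q) (trans (cong (_∙ (x ⁻¹ ∙ p)) (⁻¹-involutive x)) (\\-leftDividesˡ x p))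
               (quotients (χ-pos X x⁻¹∈) (χ-pos X x⁻¹p∈))

      -- The size of X ∩ Se.
      slice : Fin n → ℕ
      slice e = ∑ λ d → χ X d * χ S (d ∙ e ⁻¹)

      pairs-slice : pairs f (χ S) ≡ ∑ (λ e → χ X e * slice e)
      pairs-slice = begin
        ∑ (λ x → ∑ λ c → χ X (x ⁻¹) * χ X (c ⁻¹) * χ S (x ⁻¹ ∙ c))
          ≡⟨ ∑-inv (λ d → ∑ λ c → χ X d * χ X (c ⁻¹) * χ S (d ∙ c)) ⟨
        ∑ (λ d → ∑ λ c → χ X d * χ X (c ⁻¹) * χ S (d ∙ c))
          ≡⟨ ∑-cong (λ d → trans (∑-inv (λ c → χ X d * χ X (c ⁻¹) * χ S (d ∙ c)))
               (∑-cong λ e → trans (cong (λ z → χ X d * χ X z * χ S (d ∙ e ⁻¹)) (⁻¹-involutive e))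
                 (solve 3 (λ u v w → u :* v :* w := v :* (u :* w)) refl (χ X d) (χ X e) (χ S (d ∙ e ⁻¹))))) ⟩
        ∑ (λ d → ∑ λ e → χ X e * (χ X d * χ S (d ∙ e ⁻¹)))
          ≡⟨ ∑-comm (λ d e → χ X e * (χ X d * χ S (d ∙ e ⁻¹))) ⟩
        ∑ (λ e → ∑ λ d → χ X e * (χ X d * χ S (d ∙ e ⁻¹)))
          ≡⟨ ∑-cong (λ e → ∑-*ˡ (χ X e) _) ⟩
        ∑ (λ e → χ X e * slice e) ∎
        where open ≡-Reasoning

      -- Doubling `energy-lower` gives 2N³ on the left. Quotients outside S account for at most N³
      -- of it, and each pair with quotient in S for at most 2KN more, since an autocorrelation
      -- never exceeds N.
      N²≤pairs : N * N ≤ 2 * K * pairs f (χ S)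
      N²≤pairs = cancelˡ-≤ N>0 $ +-cancelˡ-≤ (N * (N * N)) _ _ $ begin
        N * (N * N) + N * (N * N)
          ≡⟨ solve 1 (λ n → n :* (n :* n) :+ n :* (n :* n) := con 2 :* (n :* n :* n)) refl N ⟩
        2 * (N * N * N)             ≤⟨ *-monoʳ-≤ 2 energy-lower ⟩
        2 * (K * pairs f r)         ≡⟨ *-assoc 2 K _ ⟨
        2 * K * pairs f r           ≡⟨ pairs-*ˡ f (2 * K) r ⟨
        pairs f (λ g → 2 * K * r g) ≤⟨ pairs-mono f pointwise ⟩
        pairs f (λ g → N + 2 * K * N * χ S g)
          ≡⟨ trans (pairs-+ f (λ _ → N) (λ g → 2 * K * N * χ S g))
               (cong₂ _+_ (trans (pairs-const f N) (cong (λ c → N * (c * c)) ∑f)) (pairs-*ˡ f (2 * K * N) (χ S))) ⟩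
        N * (N * N) + 2 * K * N * pairs f (χ S)
          ≡⟨ cong (N * (N * N) +_) (solve 3 (λ k n m → k :* n :* m := n :* (k :* m)) refl (2 * K) N (pairs f (χ S))) ⟩
        N * (N * N) + N * (2 * K * pairs f (χ S)) ∎
        where
        open ≤-Reasoning
        r = autocorr (χ X)
        pointwise : ∀ g → 2 * K * r g ≤ N + 2 * K * N * χ S g
        pointwise g with S? g
        ... | yes p = ≤-trans (*-monoʳ-≤ (2 * K) (autocorr≤ X g))
          (≤-trans
            (≤-reflexive (sym (trans (cong (2 * K * N *_) (χ-∈ (∈-setOf⁺ S? p))) (*-identityʳ (2 * K * N)))))
            (m≤n+m _ N))
        ... | no ¬p = ≤-trans (≰⇒≥ ¬p) (m≤m+n N _)

      popular-slice : ∃ λ e → N ≤ 2 * K * slice e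
      popular-slice =
        -- The weight `χ X e` confines the average to X, and `suc` adds ∑ χ X = N > 0, which makes
        -- the comparison strict.
        let e , lt = ∑-<⇒∃ {f = λ e → χ X e * N} {g = λ e → χ X e * suc (2 * K * slice e)} average
        in e , ≤-pred (*-cancelˡ-< (χ X e) _ _ lt)
        where
        open ≤-Reasoning
        average : ∑ (λ e → χ X e * N) < ∑ (λ e → χ X e * suc (2 * K * slice e))
        average = begin-strict
          ∑ (λ e → χ X e * N)       ≡⟨ trans (∑-*ʳ N (χ X)) (cong (_* N) (sym (card X))) ⟩
          N * N                     ≤⟨ N²≤pairs ⟩
          2 * K * pairs f (χ S)     ≡⟨ cong (2 * K *_) pairs-slice ⟩
          2 * K * ∑ (λ e → χ X e * slice e) ≡⟨ ∑-*ˡ (2 * K) _ ⟨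
          ∑ (λ e → 2 * K * (χ X e * slice e)) <⟨ m<n+m _ (subst (0 <_) (card X) N>0) ⟩
          ∑ (χ X) + ∑ (λ e → 2 * K * (χ X e * slice e)) ≡⟨ ∑-+ _ _ ⟨
          ∑ (λ e → χ X e + 2 * K * (χ X e * slice e))
            ≡⟨ ∑-cong (λ e → solve 3 (λ x k s → x :+ k :* (x :* s) := x :* (con 1 :+ k :* s)) refl (χ X e) (2 * K) (slice e)) ⟩
          ∑ (λ e → χ X e * suc (2 * K * slice e)) ∎

      slice≤∣S∣ : ∀ e → slice e ≤ ∣ S ∣
      slice≤∣S∣ e = begin
        ∑ (λ d → χ X d * χ S (d ∙ e ⁻¹)) ≤⟨ ∑-mono (λ d → χ*x≤x X d (χ S (d ∙ e ⁻¹))) ⟩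
        ∑ (λ d → χ S (d ∙ e ⁻¹))         ≡⟨ ∑-translateʳ (e ⁻¹) (χ S) ⟨
        ∑ (χ S)                          ≡⟨ card S ⟨
        ∣ S ∣                            ∎
        where open ≤-Reasoning

      ∣S∣-lower : N ≤ 2 * K * ∣ S ∣
      ∣S∣-lower = let e , N≤ = popular-slice in ≤-trans N≤ (*-monoʳ-≤ (2 * K) (slice≤∣S∣ e))

      -- The prefix X⁻¹ makes the induction run: the first letter s of a word stands next to some
      -- x⁻¹, and x⁻¹s = (x⁻¹c)(s⁻¹c)⁻¹ trades it for an element of Q followed by a new element of
      -- X⁻¹.
      V : ℕ → Subset n
      V k = invSet G X · pow S k

      V-step : ∀ k → ∣ V (suc k) ∣ ≤ 2 * K * K * ∣ V k ∣
      V-step k = cancelˡ-≤ N>0 $ begin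
        N * ∣ V (suc k) ∣               ≡⟨ *-comm N _ ⟩
        ∣ V (suc k) ∣ * N               ≤⟨ product-count Q (V k) (V (suc k)) (2 * K) N many ⟩
        2 * K * (∣ Q ∣ * ∣ V k ∣)       ≤⟨ *-monoʳ-≤ (2 * K) (*-monoˡ-≤ ∣ V k ∣ ∣Q∣≤) ⟩
        2 * K * (K * N * ∣ V k ∣)
          ≡⟨ solve 3 (λ k n v → con 2 :* k :* (k :* n :* v) := n :* (con 2 :* k :* k :* v)) refl K N (∣ V k ∣) ⟩
        N * (2 * K * K * ∣ V k ∣)       ∎
        where
        open ≤-Reasoning
        -- y = x⁻¹ s w = (x⁻¹ c) ((s⁻¹ c)⁻¹ w) for each of the many c ∈ X with s⁻¹ c ∈ X.
        many : ∀ {y} → y ∈ V (suc k) → N ≤ 2 * K * ∑ (λ t → χ Q t * χ (V k) (t ⁻¹ ∙ y))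
        many y∈
          with z , sw , z∈ , sw∈ , refl ← ∈-·⁻ y∈
          with s , w , s∈ , w∈ , refl ← ∈-·⁻ sw∈ = begin
          N                                        ≤⟨ ∈-setOf⁻ S? s∈ ⟩
          2 * K * ∑ (λ c → χ X c * χ X (s ⁻¹ ∙ c)) ≤⟨ *-monoʳ-≤ (2 * K) (∑-mono representation) ⟩
          2 * K * ∑ (λ c → χ Q (z ∙ c) * χ (V k) ((z ∙ c) ⁻¹ ∙ (z ∙ (s ∙ w))))
            ≡⟨ cong (2 * K *_) (∑-translateˡ z (λ t → χ Q t * χ (V k) (t ⁻¹ ∙ (z ∙ (s ∙ w))))) ⟨
          2 * K * ∑ (λ t → χ Q t * χ (V k) (t ⁻¹ ∙ (z ∙ (s ∙ w)))) ∎
          where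
          regroup : ∀ c → (s ⁻¹ ∙ c) ⁻¹ ∙ w ≡ (z ∙ c) ⁻¹ ∙ (z ∙ (s ∙ w))
          regroup c = ≡.begin
            (s ⁻¹ ∙ c) ⁻¹ ∙ w               ≡.≡⟨ cong (_∙ w) (⁻¹-anti-homo-\\ s c) ⟩
            c ⁻¹ ∙ s ∙ w                    ≡.≡⟨ assoc (c ⁻¹) s w ⟩
            c ⁻¹ ∙ (s ∙ w)                  ≡.≡⟨ cong (c ⁻¹ ∙_) (\\-leftDividesʳ z (s ∙ w)) ⟨
            c ⁻¹ ∙ (z ⁻¹ ∙ (z ∙ (s ∙ w)))   ≡.≡⟨ assoc (c ⁻¹) (z ⁻¹) _ ⟨
            c ⁻¹ ∙ z ⁻¹ ∙ (z ∙ (s ∙ w))     ≡.≡⟨ cong (_∙ (z ∙ (s ∙ w))) (⁻¹-anti-homo-∙ z c) ⟨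
            (z ∙ c) ⁻¹ ∙ (z ∙ (s ∙ w))      ≡.∎
            where module ≡ = ≡-Reasoning
          representation : ∀ c →
            χ X c * χ X (s ⁻¹ ∙ c) ≤ χ Q (z ∙ c) * χ (V k) ((z ∙ c) ⁻¹ ∙ (z ∙ (s ∙ w)))
          representation c = ≤-trans
            (χ-guard X c {y = χ Q (z ∙ c) * χ (V k) ((z ∙ c) ⁻¹ ∙ (z ∙ (s ∙ w)))} λ c∈ →
              χ-≤ X (s ⁻¹ ∙ c) λ s⁻¹c∈ → *-pos
                (≤-reflexive (sym (χ-∈ (subst (_∈ Q) (cong (_∙ c) (⁻¹-involutive z)) (quotients (∈-inv⁻ z∈) c∈)))))
                (≤-reflexive (sym (χ-∈ (subst (_∈ V k) (regroup c)
                  (∈-·⁺ (∈-inv⁺ (subst (_∈ X) (sym (⁻¹-involutive (s ⁻¹ ∙ c))) s⁻¹c∈)) w∈))))))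
            (χ*x≤x X c _)

      ∣V∣≤ : ∀ k → ∣ V k ∣ ≤ (2 * K * K) ^ k * N
      ∣V∣≤ zero = ≤-trans (p⊆q⇒∣p∣≤∣q∣ V₀⊆) (≤-reflexive (trans (∣inv∣ X) (sym (*-identityˡ N))))
        where
        V₀⊆ : V 0 ⊆ invSet G X
        V₀⊆ y∈ with z , e , z∈ , e∈ , refl ← ∈-·⁻ y∈ =
          subst (_∈ invSet G X) (sym (trans (cong (z ∙_) (x∈⁅y⁆⇒x≡y ε e∈)) (identityʳ z))) z∈
      ∣V∣≤ (suc k) = ≤-trans (V-step k) (≤-trans (*-monoʳ-≤ (2 * K * K) (∣V∣≤ k))
        (≤-reflexive (sym (*-assoc (2 * K * K) ((2 * K * K) ^ k) N))))

      ∣pow∣≤ : ∀ k → ∣ pow S k ∣ ≤ (2 * K * K) ^ k * N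
      ∣pow∣≤ k = ≤-trans ∣pow∣≤∣V∣ (∣V∣≤ k)
        where
        open ≤-Reasoning
        -- For a fixed x ∈ X the translate x⁻¹Sᵏ lies in X⁻¹Sᵏ.
        ∣pow∣≤∣V∣ : ∣ pow S k ∣ ≤ ∣ V k ∣
        ∣pow∣≤∣V∣ with x , x>0 ← ∑-pos (subst (0 <_) (card X) N>0) = begin
          ∣ pow S k ∣                 ≡⟨ card (pow S k) ⟩
          ∑ (χ (pow S k))             ≤⟨ ∑-mono (λ g → χ-mono (pow S k) (V k) λ g∈ →
            ∈-·⁺ (∈-inv⁺ (subst (_∈ X) (sym (⁻¹-involutive x)) (χ-pos X x>0))) g∈) ⟩
          ∑ (λ g → χ (V k) (x ⁻¹ ∙ g)) ≡⟨ ∑-translateˡ (x ⁻¹) (χ (V k)) ⟨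
          ∑ (χ (V k))                 ≡⟨ card (V k) ⟨
          ∣ V k ∣                     ∎

      ∣pow∣≤∣S∣ : ∀ k → ∣ pow S k ∣ ≤ (2 * K * K) ^ k * (2 * K) * ∣ S ∣
      ∣pow∣≤∣S∣ k = ≤-trans (∣pow∣≤ k) (≤-trans (*-monoʳ-≤ ((2 * K * K) ^ k) ∣S∣-lower)
        (≤-reflexive (sym (*-assoc ((2 * K * K) ^ k) (2 * K) ∣ S ∣))))

  -- Conjugates of S² as approximate subgroups.

  module Conjugation {n : ℕ} (G : FinGroup n) where
    open GroupCounting G
    open Sets G

    conjugate : Fin n → Fin n → Fin n
    conjugate d g = d ∙ g ∙ d ⁻¹

    conjugate-∙ : ∀ d g h → conjugate d (g ∙ h) ≡ conjugate d g ∙ conjugate d h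
    conjugate-∙ d g h = begin
      d ∙ (g ∙ h) ∙ d ⁻¹              ≡⟨ cong (_∙ d ⁻¹) (assoc d g h) ⟨
      d ∙ g ∙ h ∙ d ⁻¹                ≡⟨ assoc (d ∙ g) h (d ⁻¹) ⟩
      d ∙ g ∙ (h ∙ d ⁻¹)              ≡⟨ cong (d ∙ g ∙_) (\\-leftDividesʳ d (h ∙ d ⁻¹)) ⟨
      d ∙ g ∙ (d ⁻¹ ∙ (d ∙ (h ∙ d ⁻¹))) ≡⟨ assoc (d ∙ g) (d ⁻¹) _ ⟨
      d ∙ g ∙ d ⁻¹ ∙ (d ∙ (h ∙ d ⁻¹)) ≡⟨ cong (conjugate d g ∙_) (assoc d h (d ⁻¹)) ⟨
      conjugate d g ∙ conjugate d h   ∎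
      where open ≡-Reasoning

    conjugate-ε : ∀ d → conjugate d ε ≡ ε
    conjugate-ε d = trans (cong (_∙ d ⁻¹) (identityʳ d)) (inverseʳ d)

    conjugate-⁻¹ : ∀ d g → conjugate d (g ⁻¹) ≡ conjugate d g ⁻¹
    conjugate-⁻¹ d g = sym $ begin
      (d ∙ g ∙ d ⁻¹) ⁻¹               ≡⟨ ⁻¹-anti-homo-∙ (d ∙ g) (d ⁻¹) ⟩
      d ⁻¹ ⁻¹ ∙ (d ∙ g) ⁻¹            ≡⟨ cong₂ _∙_ (⁻¹-involutive d) (⁻¹-anti-homo-∙ d g) ⟩
      d ∙ (g ⁻¹ ∙ d ⁻¹)               ≡⟨ assoc d (g ⁻¹) (d ⁻¹) ⟨
      d ∙ g ⁻¹ ∙ d ⁻¹                 ∎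
      where open ≡-Reasoning

    conjugate-inverse : ∀ d u → conjugate d (d ⁻¹ ∙ u ∙ d) ≡ u
    conjugate-inverse d u = begin
      d ∙ (d ⁻¹ ∙ u ∙ d) ∙ d ⁻¹       ≡⟨ cong (λ z → d ∙ z ∙ d ⁻¹) (assoc (d ⁻¹) u d) ⟩
      d ∙ (d ⁻¹ ∙ (u ∙ d)) ∙ d ⁻¹     ≡⟨ cong (_∙ d ⁻¹) (\\-leftDividesˡ d (u ∙ d)) ⟩
      u ∙ d ∙ d ⁻¹                    ≡⟨ //-rightDividesʳ d u ⟩
      u                               ∎
      where open ≡-Reasoning

    conjugate-injective : ∀ d {g h} → conjugate d g ≡ conjugate d h → g ≡ h
    conjugate-injective d {g} {h} eq = begin
      g                               ≡⟨ undo g ⟨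
      d ⁻¹ ∙ (conjugate d g ∙ d)      ≡⟨ cong (λ z → d ⁻¹ ∙ (z ∙ d)) eq ⟩
      d ⁻¹ ∙ (conjugate d h ∙ d)      ≡⟨ undo h ⟩
      h                               ∎
      where
      open ≡-Reasoning
      undo : ∀ g → d ⁻¹ ∙ (conjugate d g ∙ d) ≡ g
      undo g = trans (cong (d ⁻¹ ∙_) (//-rightDividesˡ d (d ∙ g))) (\\-leftDividesʳ d g)

    ∈-conj-·⁺ : ∀ {d A B g u v} → u ∈ A → v ∈ B → u ∙ v ≡ conjugate d g → g ∈ conj d A · conj d B
    ∈-conj-·⁺ {d} {A} {B} {g} {u} {v} u∈ v∈ eq =
      subst (_∈ conj d A · conj d B) (conjugate-injective d collapse)
        (∈-·⁺ (∈-conj⁺ (subst (_∈ A) (sym (conjugate-inverse d u)) u∈))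
              (∈-conj⁺ (subst (_∈ B) (sym (conjugate-inverse d v)) v∈)))
      where
      collapse : conjugate d (d ⁻¹ ∙ u ∙ d ∙ (d ⁻¹ ∙ v ∙ d)) ≡ conjugate d g
      collapse = trans (conjugate-∙ d (d ⁻¹ ∙ u ∙ d) (d ⁻¹ ∙ v ∙ d))
        (trans (cong₂ _∙_ (conjugate-inverse d u) (conjugate-inverse d v)) eq)

    ∈-conj-·⁻ : ∀ {d A B g} → g ∈ conj d A · conj d B → conjugate d g ∈ A · B
    ∈-conj-·⁻ {d} {A} {B} g∈ with h , h′ , h∈ , h′∈ , refl ← ∈-·⁻ g∈ =
      subst (_∈ A · B) (sym (conjugate-∙ d h h′)) (∈-·⁺ (∈-conj⁻ h∈) (∈-conj⁻ h′∈))

    invSet≡ : ∀ {A} → (∀ {g} → g ∈ A → g ⁻¹ ∈ A) → invSet G A ≡ A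
    invSet≡ {A} closed = ⊆-antisym
      (λ {g} g∈ → subst (_∈ A) (⁻¹-involutive g) (closed (∈-inv⁻ g∈)))
      (λ g∈ → ∈-inv⁺ (closed g∈))

    module _ {S : Subset n} (ε∈S : ε ∈ S) (S-inv : ∀ {s} → s ∈ S → s ⁻¹ ∈ S)
             (c : ℕ) (∣S⁵∣≤ : ∣ pow S 5 ∣ ≤ c * ∣ S ∣) (d : Fin n) where

      open ≤-Reasoning

      private
        H = conj d (pow S 2)

        covering = ruzsa-covering (pow S 4) S (ε , ε∈S)
        C = proj₁ covering
        C⊆ = proj₁ (proj₂ covering)

        ∣C∣≤ : ∣ C ∣ ≤ c
        ∣C∣≤ = cancelˡ-≤ (card-pos (ε , ε∈S)) $ begin
          ∣ S ∣ * ∣ C ∣   ≡⟨ *-comm ∣ S ∣ ∣ C ∣ ⟩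
          ∣ C ∣ * ∣ S ∣   ≤⟨ proj₁ (proj₂ (proj₂ covering)) ⟩
          ∣ C · S ∣       ≤⟨ p⊆q⇒∣p∣≤∣q∣ C·S⊆ ⟩
          ∣ pow S 5 ∣     ≤⟨ ∣S⁵∣≤ ⟩
          c * ∣ S ∣       ≡⟨ *-comm c ∣ S ∣ ⟩
          ∣ S ∣ * c       ∎
          where
          C·S⊆ : C · S ⊆ pow S 5
          C·S⊆ g∈ with u , s , u∈ , s∈ , refl ← ∈-·⁻ g∈ = ∈-pow-+ 4 1 (C⊆ u∈) (∈-pow-1 s∈)

        -- Approximate subgroups ask for a symmetric covering set; adjoining the inverses costs a
        -- factor 2. The result stays in S⁴ = S²S² because S is symmetric.
        C± = C ∪ invSet G C

        C±-inv : ∀ {u} → u ∈ C± → u ⁻¹ ∈ C±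
        C±-inv {u} u∈ with x∈p∪q⁻ C (invSet G C) u∈
        ... | inj₁ u∈C = q⊆p∪q C (invSet G C) (∈-inv⁺ (subst (_∈ C) (sym (⁻¹-involutive u)) u∈C))
        ... | inj₂ u∈C⁻¹ = p⊆p∪q (invSet G C) (∈-inv⁻ u∈C⁻¹)

        C±⊆ : C± ⊆ pow S 4
        C±⊆ {u} u∈ with x∈p∪q⁻ C (invSet G C) u∈
        ... | inj₁ u∈C = C⊆ u∈C
        ... | inj₂ u∈C⁻¹ = subst (_∈ pow S 4) (⁻¹-involutive u) (∈-pow-inv S-inv 4 (C⊆ (∈-inv⁻ u∈C⁻¹)))

        X = conj d C±

        conj-inv : ∀ {A} → (∀ {g} → g ∈ A → g ⁻¹ ∈ A) → invSet G (conj d A) ≡ conj d A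
        conj-inv {A} closed = invSet≡ λ {g} g∈ →
          ∈-conj⁺ (subst (_∈ A) (sym (conjugate-⁻¹ d g)) (closed (∈-conj⁻ g∈)))

        ∣X∣≤ : ∣ X ∣ ≤ 2 * c
        ∣X∣≤ = begin
          ∣ X ∣                       ≡⟨ ∣conj∣ d C± ⟩
          ∣ C± ∣                      ≤⟨ ∣p∪q∣≤∣p∣+∣q∣ C (invSet G C) ⟩
          ∣ C ∣ + ∣ invSet G C ∣      ≤⟨ +-mono-≤ ∣C∣≤ (≤-trans (≤-reflexive (∣inv∣ C)) ∣C∣≤) ⟩
          c + c                       ≡⟨ cong (c +_) (+-identityʳ c) ⟨
          2 * c                       ∎

        X⊆H·H : X ⊆ H · H
        X⊆H·H g∈ with u , v , u∈ , v∈ , eq ← ∈-pow-split 2 {2} (C±⊆ (∈-conj⁻ g∈)) = 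
          ∈-conj-·⁺ {A = pow S 2} {pow S 2} u∈ v∈ eq

        -- Conjugated back, g lies in S⁴, so covering gives gs = ts′ with t ∈ C, and g = t(s′s⁻¹).
        -- The remainder s′s⁻¹ is in S², which is what H has to absorb.
        H·H⊆X·H : H · H ⊆ X · H
        H·H⊆X·H {g} g∈
          with u , v , u∈ , v∈ , uv≡g ← ∈-·⁻ (∈-conj-·⁻ g∈)
          with s , s∈ , gs∈ ← proj₂ (proj₂ (proj₂ covering)) (subst (_∈ pow S 4) uv≡g (∈-pow-+ 2 2 u∈ v∈))
          with t , s′ , t∈ , s′∈ , ts′≡gs ← ∈-·⁻ gs∈ =
          ∈-conj-·⁺ (p⊆p∪q (invSet G C) t∈) (∈-pow-+ 1 1 (∈-pow-1 s′∈) (∈-pow-1 (S-inv s∈)))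
            (trans (sym (assoc t s′ (s ⁻¹))) (trans (cong (_∙ s ⁻¹) ts′≡gs) (//-rightDividesʳ s (conjugate d g))))

        H·H·H⊆ : H · H · H ⊆ conj d (pow S 6)
        H·H·H⊆ {g} g∈ with g′ , h , g′∈ , h∈ , refl ← ∈-·⁻ g∈
          with u , v , u∈ , v∈ , uv≡ ← ∈-·⁻ (∈-conj-·⁻ g′∈) =
          ∈-conj⁺ (subst (_∈ pow S 6) (sym (conjugate-∙ d g′ h))
            (∈-pow-+ 4 2 (subst (_∈ pow S 4) uv≡ (∈-pow-+ 2 2 u∈ v∈)) (∈-conj⁻ h∈)))

      S⊆S² : S ⊆ pow S 2
      S⊆S² {s} s∈ = subst (_∈ pow S 2) (identityˡ s) (∈-pow-+ 1 1 (∈-pow-1 ε∈S) (∈-pow-1 s∈))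

      opaque
        unfolding _·_

        conj-S²-approx : IsApproxSubgroup G (ℕ→ℚ (2 * c)) H
        conj-S²-approx =
          ∈-conj⁺ (subst (_∈ pow S 2) (sym (conjugate-ε d)) (S⊆S² ε∈S)) ,
          conj-inv (∈-pow-inv S-inv 2) ,
          X , conj-inv C±-inv , X⊆H·H , ℕ→ℚ-mono ∣X∣≤ , H·H⊆X·H

        ∣H³∣≤∣S⁶∣ : ∣ prodSet G (prodSet G H H) H ∣ ≤ ∣ pow S 6 ∣
        ∣H³∣≤∣S⁶∣ = ≤-trans (p⊆q⇒∣p∣≤∣q∣ H·H·H⊆) (≤-reflexive (∣conj∣ d (pow S 6)))

      ∣S∣≤∣H∣ : ∣ S ∣ ≤ ∣ H ∣
      ∣S∣≤∣H∣ = ≤-trans (p⊆q⇒∣p∣≤∣q∣ S⊆S²) (≤-reflexive (sym (∣conj∣ d (pow S 2))))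

  -- Numerical inequalities between the cardinalities.

  fibre-large : ∀ {v a b N E L} → 0 < a * b → a * b * b ≤ L * E → E ≤ v * (a * b) * N → b ≤ v * L * N
  fibre-large {v} {a} {b} {N} {E} {L} ab>0 abb≤ E≤ = cancelˡ-≤ ab>0 $ begin
    a * b * b                  ≤⟨ abb≤ ⟩
    L * E                      ≤⟨ *-monoʳ-≤ L E≤ ⟩
    L * (v * (a * b) * N)
      ≡⟨ solve 4 (λ l v c n → l :* (v :* c :* n) := c :* (v :* l :* n)) refl L v (a * b) N ⟩
    a * b * (v * L * N)        ∎
    where open ≤-Reasoning

  popular-small : ∀ {u a b D E L} → 0 < a * b * b → a * b * b ≤ L * E →
    D * E ≤ u * (a * a) * (b * b) → D ≤ u * L * a
  popular-small {u} {a} {b} {D} {E} {L} pos abb≤ DE≤ = cancelˡ-≤ pos $ begin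
    a * b * b * D              ≤⟨ *-monoˡ-≤ D abb≤ ⟩
    L * E * D                  ≡⟨ solve 3 (λ l e d → l :* e :* d := l :* (d :* e)) refl L E D ⟩
    L * (D * E)                ≤⟨ *-monoʳ-≤ L DE≤ ⟩
    L * (u * (a * a) * (b * b))
      ≡⟨ solve 4 (λ l u a b → l :* (u :* (a :* a) :* (b :* b)) := a :* b :* b :* (u :* l :* a)) refl
        L u a b ⟩
    a * b * b * (u * L * a)    ∎
    where open ≤-Reasoning

  -- Q is at most 2D²/N ≤ 2w²N ≤ 4w²M; this 4w² is the value later given to K.
  square-small : ∀ {w D Q N M K} → 0 < N → Q * N ≤ 2 * (D * D) → D ≤ w * N → N ≤ 2 * M →
    4 * (w * w) ≤ K → Q ≤ K * M
  square-small {w} {D} {Q} {N} {M} {K} N>0 QN≤ D≤ N≤ K≥ = begin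
    Q                          ≤⟨ cancelˡ-≤ N>0 QN≤′ ⟩
    2 * (w * w) * N            ≤⟨ *-monoʳ-≤ (2 * (w * w)) N≤ ⟩
    2 * (w * w) * (2 * M)
      ≡⟨ solve 2 (λ w m → con 2 :* (w :* w) :* (con 2 :* m) := con 4 :* (w :* w) :* m) refl w M ⟩
    4 * (w * w) * M            ≤⟨ *-monoˡ-≤ M K≥ ⟩
    K * M                      ∎
    where
    open ≤-Reasoning
    QN≤′ : N * Q ≤ N * (2 * (w * w) * N)
    QN≤′ = begin
      N * Q                    ≡⟨ *-comm N Q ⟩
      Q * N                    ≤⟨ QN≤ ⟩
      2 * (D * D)              ≤⟨ *-monoʳ-≤ 2 (*-mono-≤ D≤ D≤) ⟩
      2 * (w * N * (w * N))
        ≡⟨ solve 2 (λ w n → con 2 :* (w :* n :* (w :* n)) := n :* (con 2 :* (w :* w) :* n)) refl w N ⟩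
      N * (2 * (w * w) * N)    ∎

  slice-bound : ∀ {b t N M K s r} → b ≤ t * N → N ≤ 2 * M → M ≤ 2 * K * s → s ≤ r → b ≤ t * 2 * (2 * K) * r
  slice-bound {b} {t} {N} {M} {K} {s} {r} b≤ N≤ M≤ s≤ = begin
    b                          ≤⟨ b≤ ⟩
    t * N
      ≤⟨ *-monoʳ-≤ t (≤-trans N≤ (*-monoʳ-≤ 2 (≤-trans M≤ (*-monoʳ-≤ (2 * K) s≤)))) ⟩
    t * (2 * (2 * K * r))
      ≡⟨ solve 3 (λ t k r → t :* (con 2 :* (k :* r)) := t :* con 2 :* k :* r) refl t (2 * K) r ⟩
    t * 2 * (2 * K) * r        ∎
    where open ≤-Reasoning

  sqrt-≤ : ∀ {x y} → x * x ≤ y * y → x ≤ y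
  sqrt-≤ {x} {y} xx≤yy with ≤-total x y
  ... | inj₁ x≤y = x≤y
  ... | inj₂ y≤x = ≮⇒≥ λ y<x → <⇒≱ (*-mono-< y<x y<x) xx≤yy

  -- The trivial bound E ≤ ab² turns the hypothesis into a ≤ k²b. Hence (a²b)² = a³b²·a ≤ k²(ab)³ ≤
  -- (k²E)². The companion bound on ab² follows by exchanging a and b.
  energy-lower-bound : ∀ {a b E k} → 0 < a → 0 < b →
    (a * b) ^ 3 ≤ E ^ 2 * k ^ 2 → E ≤ b * (a * b) →
    a * b * a ≤ k * k * E
  energy-lower-bound {a} {b} {E} {k} a>0 b>0 hyp E≤ = sqrt-≤ $ begin
    a * b * a * (a * b * a)
      ≡⟨ solve 2 (λ a b → a :* b :* a :* (a :* b :* a) := a :* b :* (a :* b) :* a :* a) refl a b ⟩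
    a * b * (a * b) * a * a          ≤⟨ *-monoʳ-≤ (a * b * (a * b) * a) a≤bkk ⟩
    a * b * (a * b) * a * (b * (k * k))
      ≡⟨ solve 3 (λ a b k → a :* b :* (a :* b) :* a :* (b :* (k :* k)) := a :* b :* (a :* b :* (a :* b :* con 1)) :* (k :* k)) refl
        a b k ⟩
    (a * b) ^ 3 * (k * k)            ≤⟨ *-monoˡ-≤ (k * k) hyp ⟩
    E ^ 2 * k ^ 2 * (k * k)
      ≡⟨ solve 2 (λ e k → e :* (e :* con 1) :* (k :* (k :* con 1)) :* (k :* k) := k :* k :* e :* (k :* k :* e)) refl
        E k ⟩
    k * k * E * (k * k * E)          ∎
    where
    open ≤-Reasoning
    abb : ℕ
    abb = a * b * (a * b) * b
    a≤bkk : a ≤ b * (k * k)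
    a≤bkk = cancelˡ-≤ {abb} (*-pos (*-pos (*-pos a>0 b>0) (*-pos a>0 b>0)) b>0) $ begin
      abb * a
        ≡⟨ solve 2 (λ a b → a :* b :* (a :* b) :* b :* a := a :* b :* (a :* b :* (a :* b :* con 1))) refl
          a b ⟩
      (a * b) ^ 3                    ≤⟨ hyp ⟩
      E ^ 2 * k ^ 2                  ≤⟨ *-monoˡ-≤ (k ^ 2) (*-mono-≤ E≤ (*-monoˡ-≤ 1 E≤)) ⟩
      b * (a * b) * (b * (a * b) * 1) * k ^ 2
        ≡⟨ solve 3 (λ a b k → b :* (a :* b) :* (b :* (a :* b) :* con 1) :* (k :* (k :* con 1))
          := a :* b :* (a :* b) :* b :* (b :* (k :* k)))
          refl a b k ⟩
      abb * (b * (k * k))            ∎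

  -- Assembly of the combinatorial statement over ℕ.

  module Combine {n : ℕ} (G : FinGroup n) where
    open GroupCounting G
    open BSG G
    open Sets G
    open Conjugation G

    -- L stands for k². Two energy bounds are assumed since A and B may differ in size: the one on
    -- a²b compares |A| with the fibre P, the one on ab² compares |B| with P and also bounds D.
    energy-bsg : (A B : Subset n) (L K : ℕ) →
      let a = ∣ A ∣; b = ∣ B ∣; E = pairs (χ A) (autocorr (χ B)) in
      0 < a → 0 < b → 0 < E → 0 < K →
      a * b * a ≤ L * E → a * b * b ≤ L * E →
      4 * (64 * L * (4 * L) * (64 * L * (4 * L))) ≤ K →
      Σ (Subset n) λ H → Σ (Fin n) λ x → Σ (Fin n) λ y →
        IsApproxSubgroup G (ℕ→ℚ (2 * ((2 * K * K) ^ 5 * (2 * K)))) H ×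
        ∣ H ∣ ≤ (2 * K * K) ^ 2 * a ×
        a ≤ 4 * L * 2 * (2 * K) * ∣ A ∩ leftTr G x H ∣ ×
        b ≤ 4 * L * 2 * (2 * K) * ∣ B ∩ rightTr G H y ∣ ×
        ∣ prodSet G (prodSet G H H) H ∣ ≤ (2 * K * K) ^ 6 * (2 * K) * ∣ H ∣
    energy-bsg A B L K a>0 b>0 E>0 K>0 a²b≤ ab²≤ K≥ =
      -- If c ∈ X and s = cd⁻¹ ∈ S, then c = d(d⁻¹sd) is in A and c⁻¹p = (d⁻¹s⁻¹d)(d⁻¹p) is in B,
      -- which dictates the two translating elements.
      H , d , d ⁻¹ ∙ p
      , conj-S²-approx ε∈S′ S-inv′ ((2 * K * K) ^ 5 * (2 * K)) (∣pow∣≤∣S∣ ∣X∣>0 K>0 quotients ∣Q∣≤ 5) d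
      , ∣H∣≤
      , slice-bound {t = 4 * L} {K = K} a≤ N≤2∣X∣ M≤slice slice≤A
      , slice-bound {t = 4 * L} {K = K} b≤ N≤2∣X∣ M≤slice slice≤B
      , ∣H³∣≤
      where
      open ≤-Reasoning
      a = ∣ A ∣
      b = ∣ B ∣
      E = pairs (χ A) (autocorr (χ B))
      ab>0 : 0 < a * b
      ab>0 = *-pos a>0 b>0
      D = Pop B (64 * (a * a)) E

      dense = dense-fibre A B a>0 b>0 E>0
      p = proj₁ dense
      P = fibreSet A B p
      N = ∣ P ∣
      E<4abN : E < 4 * (a * b) * N
      E<4abN = proj₁ (proj₂ dense)

      N>0 : 0 < N
      N>0 = proj₂ (*-pos⁻ (4 * (a * b)) N (≤-trans (s≤s z≤n) E<4abN))

      a≤ : a ≤ 4 * L * N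
      a≤ = fibre-large {v = 4} {a = b} {b = a} {L = L}
        (*-pos b>0 a>0) (≤-trans (≤-reflexive (cong (_* a) (*-comm b a))) a²b≤)
        (≤-trans (<⇒≤ E<4abN) (≤-reflexive (cong (λ c → 4 * c * N) (*-comm a b))))

      b≤ : b ≤ 4 * L * N
      b≤ = fibre-large {v = 4} {a = a} {b = b} {L = L} ab>0 ab²≤ (<⇒≤ E<4abN)

      ∣D∣≤ : ∣ D ∣ ≤ 64 * L * (4 * L) * N
      ∣D∣≤ = begin
        ∣ D ∣
          ≤⟨ popular-small {u = 64} {a = a} {b = b} {L = L} (*-pos ab>0 b>0) ab²≤ (∣Pop∣≤ B (64 * (a * a)) E) ⟩
        64 * L * a                ≤⟨ *-monoʳ-≤ (64 * L) a≤ ⟩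
        64 * L * (4 * L * N)      ≡⟨ *-assoc (64 * L) (4 * L) N ⟨
        64 * L * (4 * L) * N      ∎

      refined = refine P D N>0 (<⇒≤ (proj₂ (proj₂ dense)))
      X = proj₁ refined
      X⊆P : X ⊆ P
      X⊆P = proj₁ (proj₂ refined)
      N≤2∣X∣ : N ≤ 2 * ∣ X ∣
      N≤2∣X∣ = proj₁ (proj₂ (proj₂ refined))

      ∣X∣>0 : 0 < ∣ X ∣
      ∣X∣>0 = proj₂ (*-pos⁻ 2 ∣ X ∣ (≤-trans N>0 N≤2∣X∣))

      Q = Pop D 2 N
      quotients : ∀ {x y} → x ∈ X → y ∈ X → x ⁻¹ ∙ y ∈ Q
      quotients x∈ y∈ = ∈-setOf⁺ (Popular? D 2 N) (proj₂ (proj₂ (proj₂ refined)) x∈ y∈)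

      ∣Q∣≤ : ∣ Q ∣ ≤ K * ∣ X ∣
      ∣Q∣≤ = square-small {w = 64 * L * (4 * L)} N>0 (∣Pop∣≤ D 2 N) ∣D∣≤ N≤2∣X∣ K≥

      open Symmetry G X Q K hiding (N)

      ε∈S′ : ε ∈ S
      ε∈S′ = ε∈S ∣X∣>0 K>0 quotients ∣Q∣≤
      S-inv′ : ∀ {s} → s ∈ S → s ⁻¹ ∈ S
      S-inv′ = S-inv ∣X∣>0 K>0 quotients ∣Q∣≤

      popular = popular-slice ∣X∣>0 K>0 quotients ∣Q∣≤
      d = proj₁ popular
      s = ∑ λ c → χ X c * χ S (c ∙ d ⁻¹)
      M≤slice : ∣ X ∣ ≤ 2 * K * s
      M≤slice = proj₂ popular

      H = conj d (pow S 2)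

      S⊆S²′ : S ⊆ pow S 2
      S⊆S²′ = S⊆S² ε∈S′ S-inv′ ((2 * K * K) ^ 5 * (2 * K)) (∣pow∣≤∣S∣ ∣X∣>0 K>0 quotients ∣Q∣≤ 5) d

      X⊆A : ∀ {x} → x ∈ X → x ∈ A × x ⁻¹ ∙ p ∈ B
      X⊆A {x} x∈ = let u , v = *-pos⁻ (χ A x) (χ B (x ⁻¹ ∙ p))
                             (≤-reflexive (trans (sym (χ-∈ (X⊆P x∈))) (χ-fibreSet A B p x)))
        in χ-pos A u , χ-pos B v

      slice-≤ : {f : Fin n → ℕ} → (∀ {c} → c ∈ X → c ∙ d ⁻¹ ∈ S → 1 ≤ f c) → s ≤ ∑ f
      slice-≤ {f} h = ∑-mono λ c → ≤-trans
        (χ-guard X c {y = f c} λ c∈ → χ-≤ S (c ∙ d ⁻¹) (h c∈))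
        (χ*x≤x X c (f c))

      slice≤A : s ≤ ∣ A ∩ leftTr G d H ∣
      slice≤A = ≤-trans
        (slice-≤ λ {c} c∈ cd⁻¹∈ → ≤-reflexive (sym (χ-∈ (x∈p∩q⁺
          (proj₁ (X⊆A c∈) ,
           ∈-tabulate⁺ (λ g → lookup H (d ⁻¹ ∙ g)) ([]=⇒lookup (∈-conj⁺ (subst (_∈ pow S 2)
             (cong (_∙ d ⁻¹) (sym (\\-leftDividesˡ d c))) (S⊆S²′ cd⁻¹∈)))))))))
        (≤-reflexive (sym (card (A ∩ leftTr G d H))))

      slice≤B : s ≤ ∣ B ∩ rightTr G H (d ⁻¹ ∙ p) ∣
      slice≤B = begin
        s                                 ≤⟨ slice-≤ (λ {c} c∈ cd⁻¹∈ → ≤-reflexive (sym (χ-∈ (x∈p∩q⁺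
          (proj₂ (X⊆A c∈) ,
           ∈-tabulate⁺ (λ g → lookup H (g ∙ y ⁻¹)) ([]=⇒lookup (∈-conj⁺ (subst (_∈ pow S 2)
             (regroup c) (S⊆S²′ (S-inv′ cd⁻¹∈)))))))))) ⟩
        ∑ (λ c → χ R (c ⁻¹ ∙ p))          ≡⟨ ∑-inv (λ c → χ R (c ∙ p)) ⟨
        ∑ (λ c → χ R (c ∙ p))             ≡⟨ ∑-translateʳ p (χ R) ⟨
        ∑ (χ R)                           ≡⟨ card R ⟨
        ∣ R ∣                             ∎
        where
        y = d ⁻¹ ∙ p
        R = B ∩ rightTr G H y
        regroup : ∀ c → (c ∙ d ⁻¹) ⁻¹ ≡ conjugate d (c ⁻¹ ∙ p ∙ y ⁻¹)
        regroup c = ≡.begin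
          (c ∙ d ⁻¹) ⁻¹
            ≡.≡⟨ trans (⁻¹-anti-homo-∙ c (d ⁻¹)) (cong (_∙ c ⁻¹) (⁻¹-involutive d)) ⟩
          d ∙ c ⁻¹                             ≡.≡⟨ //-rightDividesʳ d (d ∙ c ⁻¹) ⟨
          d ∙ c ⁻¹ ∙ d ∙ d ⁻¹                  ≡.≡⟨ cong (_∙ d ⁻¹) (assoc d (c ⁻¹) d) ⟩
          d ∙ (c ⁻¹ ∙ d) ∙ d ⁻¹                ≡.≡⟨ cong (λ z → d ∙ (c ⁻¹ ∙ z) ∙ d ⁻¹) p∙y⁻¹ ⟨
          d ∙ (c ⁻¹ ∙ (p ∙ y ⁻¹)) ∙ d ⁻¹       ≡.≡⟨ cong (λ z → d ∙ z ∙ d ⁻¹) (assoc (c ⁻¹) p (y ⁻¹)) ⟨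
          conjugate d (c ⁻¹ ∙ p ∙ y ⁻¹)        ≡.∎
          where
          module ≡ = ≡-Reasoning
          p∙y⁻¹ : p ∙ y ⁻¹ ≡ d
          p∙y⁻¹ = trans (cong (p ∙_) (⁻¹-anti-homo-\\ d p)) (\\-leftDividesˡ p d)

      ∣H∣≤ : ∣ H ∣ ≤ (2 * K * K) ^ 2 * a
      ∣H∣≤ = begin
        ∣ H ∣                     ≡⟨ ∣conj∣ d (pow S 2) ⟩
        ∣ pow S 2 ∣               ≤⟨ ∣pow∣≤ ∣X∣>0 K>0 quotients ∣Q∣≤ 2 ⟩
        (2 * K * K) ^ 2 * ∣ X ∣   ≤⟨ *-monoʳ-≤ ((2 * K * K) ^ 2) (p⊆q⇒∣p∣≤∣q∣ (proj₁ ∘ X⊆A)) ⟩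
        (2 * K * K) ^ 2 * a       ∎

      ∣H³∣≤ : ∣ prodSet G (prodSet G H H) H ∣ ≤ (2 * K * K) ^ 6 * (2 * K) * ∣ H ∣
      ∣H³∣≤ = begin
        ∣ prodSet G (prodSet G H H) H ∣      ≤⟨ ∣H³∣≤∣S⁶∣ ε∈S′ S-inv′ ((2 * K * K) ^ 5 * (2 * K)) S⁵ d ⟩
        ∣ pow S 6 ∣                          ≤⟨ ∣pow∣≤∣S∣ ∣X∣>0 K>0 quotients ∣Q∣≤ 6 ⟩
        (2 * K * K) ^ 6 * (2 * K) * ∣ S ∣
          ≤⟨ *-monoʳ-≤ ((2 * K * K) ^ 6 * (2 * K)) (∣S∣≤∣H∣ ε∈S′ S-inv′ ((2 * K * K) ^ 5 * (2 * K)) S⁵ d) ⟩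
        (2 * K * K) ^ 6 * (2 * K) * ∣ H ∣    ∎
        where S⁵ = ∣pow∣≤∣S∣ ∣X∣>0 K>0 quotients ∣Q∣≤ 5

    module _ (A B : Subset n) where
      private
        a = ∣ A ∣
        b = ∣ B ∣
        E = pairs (χ A) (autocorr (χ B))
        h : Fin n → ℕ
        h p = ∑ (fibre (χ A) (χ B) p)

        ∑h : ∑ h ≡ a * b
        ∑h = trans (∑-fibre (χ A) (χ B)) (cong₂ _*_ (sym (card A)) (sym (card B)))

        -- The energy is the second moment of the fibre sizes, hence at most their maximum times
        -- their sum ab; a fibre has at most min(a,b) elements.
        E≤ : ∀ {m} → (∀ p → h p ≤ m) → E ≤ m * (a * b)
        E≤ {m} h≤m = begin
          E                       ≡⟨ ∑-fibre² (χ A) (χ B) ⟨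
          ∑ (λ p → h p * h p)     ≤⟨ ∑-mono (λ p → *-monoˡ-≤ (h p) (h≤m p)) ⟩
          ∑ (λ p → m * h p)       ≡⟨ ∑-*ˡ m h ⟩
          m * ∑ h                 ≡⟨ cong (m *_) ∑h ⟩
          m * (a * b)             ∎
          where open ≤-Reasoning

      energy≤a²b : E ≤ a * (a * b)
      energy≤a²b = E≤ λ p → ≤-trans
        (∑-mono λ x → x*χ≤x B (x ⁻¹ ∙ p) (χ A x))
        (≤-reflexive (sym (card A)))

      energy≤ab² : E ≤ b * (a * b)
      energy≤ab² = E≤ λ p → ≤-trans
        (∑-mono λ x → χ*x≤x A x (χ B (x ⁻¹ ∙ p)))
        (≤-reflexive (trans (sym (trans (∑-translateʳ p (χ B)) (∑-inv (λ x → χ B (x ∙ p))))) (sym (card B))))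

-- Return to rational constants, and the theorem.

open import Data.Nat using (ℕ)
open import Data.Fin using (Fin)
open import Data.Fin.Subset using (Subset; Nonempty; ∣_∣; _∩_)
open import Data.Rational using (ℚ; _≤_; _*_; 1ℚ)
open import Data.Product using (Σ; _×_)
open import Data.Nat as ℕ using (zero; suc; z≤n; s≤s)
import Data.Nat.Properties as ℕ
open import Data.Rational using (0ℚ; _<_; positive; nonNegative)
open import Data.Rational.Properties as ℚ using (≤-trans; ≤-reflexive)
open import Data.Rational.Solver using (module +-*-Solver)
open import Data.Product using (_,_; proj₂)
open import Function using (_$_)
open import Relation.Nullary.Decidable using (True; toWitness)
open import Relation.Binary.PropositionalEquality
open RationalPowers
open Counting using (module GroupCounting; module Combine; χ; card-pos; *-pos; *-pos⁻; energy-lower-bound)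

-- A record rather than a bare equation, so that e, f and c are inferred by unification
-- and the numerals never get unfolded.
record Monomial (k e f c : ℕ) : Set where
  constructor monomial
  field monomial-≡ : c ≡ 2 ℕ.^ e ℕ.* k ℕ.^ f
open Monomial

module _ {k : ℕ} where
  open ≡-Reasoning

  monomial-* : ∀ {e f c e′ f′ c′} → Monomial k e f c → Monomial k e′ f′ c′ →
    Monomial k (e ℕ.+ e′) (f ℕ.+ f′) (c ℕ.* c′)
  monomial-* {e} {f} {_} {e′} {f′} (monomial refl) (monomial refl) = monomial $ begin
    2 ℕ.^ e ℕ.* k ℕ.^ f ℕ.* (2 ℕ.^ e′ ℕ.* k ℕ.^ f′)
      ≡⟨ ℕ.[m*n]*[o*p]≡[m*o]*[n*p] (2 ℕ.^ e) (k ℕ.^ f) (2 ℕ.^ e′) (k ℕ.^ f′) ⟩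
    2 ℕ.^ e ℕ.* 2 ℕ.^ e′ ℕ.* (k ℕ.^ f ℕ.* k ℕ.^ f′)
      ≡⟨ cong₂ ℕ._*_ (ℕ.^-distribˡ-+-* 2 e e′) (ℕ.^-distribˡ-+-* k f f′) ⟨
    2 ℕ.^ (e ℕ.+ e′) ℕ.* k ℕ.^ (f ℕ.+ f′) ∎

  monomial-^ : ∀ {e f c} m → Monomial k e f c → Monomial k (m ℕ.* e) (m ℕ.* f) (c ℕ.^ m)
  monomial-^ zero M = monomial refl
  monomial-^ (suc m) M = monomial-* M (monomial-^ m M)

  monomial-2^ : ∀ e → Monomial k e 0 (2 ℕ.^ e)
  monomial-2^ e = monomial $ sym (ℕ.*-identityʳ (2 ℕ.^ e))

  -- Replacing k by 2α in kᶠ produces f further factors 2, hence the condition on e + f.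
  monomial-≤ : ∀ {α} → 1ℚ ≤ α → ℕ→ℚ k ≤ ℕ→ℚ 2 * α → ∀ {e f c} → Monomial k e f c →
    ∀ E F → e ℕ.+ f ℕ.≤ E → f ℕ.≤ F → ℕ→ℚ c ≤ (ℕ→ℚ 2 ^ℚ E) * (α ^ℚ F)
  monomial-≤ {α} 1≤α k≤2α {e} {f} {c} M E F e+f≤E f≤F = R.begin
    ℕ→ℚ c                                   R.≡⟨ cong ℕ→ℚ (monomial-≡ M) ⟩
    ℕ→ℚ (2 ℕ.^ e ℕ.* k ℕ.^ f)
      R.≡⟨ trans (ℕ→ℚ-* (2 ℕ.^ e) (k ℕ.^ f)) (cong₂ _*_ (ℕ→ℚ-^ 2 e) (ℕ→ℚ-^ k f)) ⟩
    (two ^ℚ e) * (ℕ→ℚ k ^ℚ f)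
      R.≤⟨ ℚ.*-monoˡ-≤-nonNeg (two ^ℚ e) {{nonNegative (^ℚ-nonneg e 0≤two)}} (^ℚ-mono f (0≤ℕ→ℚ k) k≤2α) ⟩
    (two ^ℚ e) * ((two * α) ^ℚ f)           R.≡⟨ cong (two ^ℚ e *_) (^ℚ-distrib-* two α f) ⟩
    (two ^ℚ e) * (two ^ℚ f * α ^ℚ f)        R.≡⟨ ℚ.*-assoc (two ^ℚ e) (two ^ℚ f) (α ^ℚ f) ⟨
    ((two ^ℚ e) * (two ^ℚ f)) * (α ^ℚ f)    R.≡⟨ cong (_* α ^ℚ f) (^ℚ-+ two e f) ⟨
    (two ^ℚ (e ℕ.+ f)) * (α ^ℚ f)
      R.≤⟨ *-mono-≤₀ (^ℚ-nonneg (e ℕ.+ f) 0≤two) (^ℚ-nonneg F (≤-trans (0≤ℕ→ℚ 1) 1≤α))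
                                                    (^ℚ-monoʳ {k = E} 1≤two e+f≤E) (^ℚ-monoʳ {k = F} 1≤α f≤F) ⟩
    (two ^ℚ E) * (α ^ℚ F)                   R.∎
    where
    module R = ℚ.≤-Reasoning
    two = ℕ→ℚ 2
    0≤two : 0ℚ ≤ two
    0≤two = 0≤ℕ→ℚ 2
    1≤two : 1ℚ ≤ two
    1≤two = ℕ→ℚ-mono {1} {2} (s≤s z≤n)

-- This bound is wanted with α itself and not with k, so it is derived in ℚ: E ≤ ab² gives (ab)³ ≤
-- (ab²)²α², and t = a²b³ cancels.
ratio-bound : ∀ {a b E α} → 0 ℕ.< a → 0 ℕ.< b →
  ℕ→ℚ (a ℕ.* b) ^ℚ 3 ≤ (ℕ→ℚ E ^ℚ 2) * (α ^ℚ 2) → 0ℚ ≤ α → E ℕ.≤ b ℕ.* (a ℕ.* b) →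
  ℕ→ℚ a ≤ (α ^ℚ 2) * ℕ→ℚ b
ratio-bound {a} {b} {E} {α} a>0 b>0 hyp 0≤α E≤ =
  ℚ.*-cancelˡ-≤-pos t {{positive t>0}} $ begin
    t * p                          ≡⟨ cong (_* p) t≡ ⟩
    p * q * (p * q) * q * p
      ≡⟨ solve 2 (λ p q → p :* q :* (p :* q) :* q :* p := p :* q :* (p :* q :* (p :* q :* con 1ℚ))) refl
        p q ⟩
    (p * q) ^ℚ 3                   ≡⟨ cong (_^ℚ 3) ab ⟨
    ℕ→ℚ (a ℕ.* b) ^ℚ 3             ≤⟨ hyp ⟩
    (ℕ→ℚ E ^ℚ 2) * (α ^ℚ 2)
      ≤⟨ ℚ.*-monoʳ-≤-nonNeg (α ^ℚ 2) {{nonNegative (^ℚ-nonneg 2 0≤α)}} (^ℚ-mono 2 (0≤ℕ→ℚ E) (ℕ→ℚ-mono E≤)) ⟩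
    (ℕ→ℚ (b ℕ.* (a ℕ.* b)) ^ℚ 2) * (α ^ℚ 2)
      ≡⟨ cong (λ z → (z ^ℚ 2) * (α ^ℚ 2)) (trans (ℕ→ℚ-* b (a ℕ.* b)) (cong (q *_) ab)) ⟩
    ((q * (p * q)) ^ℚ 2) * (α ^ℚ 2)
      ≡⟨ solve 3 (λ p q s → q :* (p :* q) :* (q :* (p :* q) :* con 1ℚ) :* s := p :* q :* (p :* q) :* q :* (s :* q)) refl
        p q (α ^ℚ 2) ⟩
    p * q * (p * q) * q * ((α ^ℚ 2) * q) ≡⟨ cong (_* ((α ^ℚ 2) * q)) t≡ ⟨
    t * ((α ^ℚ 2) * q)             ∎
  where
  open ℚ.≤-Reasoning
  open +-*-Solver
  p = ℕ→ℚ a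
  q = ℕ→ℚ b
  t = ℕ→ℚ (a ℕ.* b ℕ.* (a ℕ.* b) ℕ.* b)
  ab : ℕ→ℚ (a ℕ.* b) ≡ p * q
  ab = ℕ→ℚ-* a b
  t≡ : t ≡ p * q * (p * q) * q
  t≡ = trans (ℕ→ℚ-* (a ℕ.* b ℕ.* (a ℕ.* b)) b)
    (cong (_* q) (trans (ℕ→ℚ-* (a ℕ.* b) (a ℕ.* b)) (cong₂ _*_ ab ab)))
  t>0 : 0ℚ < t
  t>0 = ℚ.<-≤-trans (ℚ.positive⁻¹ 1ℚ) (ℕ→ℚ-mono {1} (*-pos (*-pos (*-pos a>0 b>0) (*-pos a>0 b>0)) b>0))

natural-hypothesis : ∀ {c E k α} → 0ℚ ≤ α → α ≤ ℕ→ℚ k →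
  ℕ→ℚ c ^ℚ 3 ≤ (ℕ→ℚ E ^ℚ 2) * (α ^ℚ 2) → c ℕ.^ 3 ℕ.≤ E ℕ.^ 2 ℕ.* k ℕ.^ 2
natural-hypothesis {c} {E} {k} {α} 0≤α α≤k hyp = ℕ→ℚ-cancel $ begin
  ℕ→ℚ (c ℕ.^ 3)                    ≡⟨ ℕ→ℚ-^ c 3 ⟩
  ℕ→ℚ c ^ℚ 3                       ≤⟨ hyp ⟩
  (ℕ→ℚ E ^ℚ 2) * (α ^ℚ 2)
    ≤⟨ ℚ.*-monoˡ-≤-nonNeg (ℕ→ℚ E ^ℚ 2) {{nonNegative (^ℚ-nonneg 2 (0≤ℕ→ℚ E))}} (^ℚ-mono 2 0≤α α≤k) ⟩
  (ℕ→ℚ E ^ℚ 2) * (ℕ→ℚ k ^ℚ 2)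
    ≡⟨ trans (ℕ→ℚ-* (E ℕ.^ 2) (k ℕ.^ 2)) (cong₂ _*_ (ℕ→ℚ-^ E 2) (ℕ→ℚ-^ k 2)) ⟨
  ℕ→ℚ (E ℕ.^ 2 ℕ.* k ℕ.^ 2)        ∎
  where open ℚ.≤-Reasoning

ℕ→ℚ-≤-* : ∀ {m} c r → m ℕ.≤ c ℕ.* r → ℕ→ℚ m ≤ ℕ→ℚ c * ℕ→ℚ r
ℕ→ℚ-≤-* {m} c r m≤ = ≤-trans (ℕ→ℚ-mono m≤) (≤-reflexive (ℕ→ℚ-* c r))

ControlledByApproxSubgroup : {n : ℕ} → FinGroup n → ℚ → Subset n → Subset n → Set
ControlledByApproxSubgroup {n} G α A B =
  Σ ℚ λ β₁ → Σ ℚ λ β₂ → Σ ℚ λ β₃ → Σ ℚ λ β₄ →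
    (1ℚ ≤ β₁ × 1ℚ ≤ β₂ × 1ℚ ≤ β₃ × 1ℚ ≤ β₄) ×
    (β₁ ≤ (ℕ→ℚ 2 ^ℚ 1861) * (α ^ℚ 720) ×
     β₂ ≤ (ℕ→ℚ 2 ^ℚ 325) * (α ^ℚ 126) ×
     β₃ ≤ (ℕ→ℚ 2 ^ℚ 2424) * (α ^ℚ 937) ×
     β₄ ≤ (ℕ→ℚ 2 ^ℚ 930) * (α ^ℚ 360)) ×
    Σ (Subset n) λ H → Σ (Fin n) λ x → Σ (Fin n) λ y →
      IsApproxSubgroup G β₁ H ×
      ℕ→ℚ ∣ H ∣ ≤ β₂ * ℕ→ℚ ∣ A ∣ ×
      β₂ * ℕ→ℚ ∣ A ∣ ≤ β₂ * (α ^ℚ 2) * ℕ→ℚ ∣ B ∣ ×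
      ℕ→ℚ ∣ A ∣ ≤ β₃ * ℕ→ℚ ∣ A ∩ leftTr G x H ∣ ×
      ℕ→ℚ ∣ B ∣ ≤ β₃ * ℕ→ℚ ∣ B ∩ rightTr G H y ∣ ×
      ℕ→ℚ ∣ prodSet G (prodSet G H H) H ∣ ≤ β₄ * ℕ→ℚ ∣ H ∣

module _ {n : ℕ} (G : FinGroup n) (α : ℚ) (1≤α : 1ℚ ≤ α)
  (A B : Subset n) (A≠∅ : Nonempty A) (B≠∅ : Nonempty B)
  (hyp : ℕ→ℚ (∣ A ∣ ℕ.* ∣ B ∣) ^ℚ 3 ≤ (ℕ→ℚ (energy G A B) ^ℚ 2) * (α ^ℚ 2))
  (k : ℕ) (α≤k : α ≤ ℕ→ℚ k) (k≤2α : ℕ→ℚ k ≤ ℕ→ℚ 2 * α) (K : ℕ) (K≡ : Monomial k 18 8 K) where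

  open GroupCounting G using (energy≡pairs; pairs; autocorr)
  open Combine G

  private
    a = ∣ A ∣
    b = ∣ B ∣
    E = pairs (χ A) (autocorr (χ B))
    a>0 = card-pos A≠∅
    b>0 = card-pos B≠∅
    0≤α = ≤-trans (0≤ℕ→ℚ 1) 1≤α
    hypE : ℕ→ℚ (a ℕ.* b) ^ℚ 3 ≤ (ℕ→ℚ E ^ℚ 2) * (α ^ℚ 2)
    hypE = subst (λ z → ℕ→ℚ (a ℕ.* b) ^ℚ 3 ≤ (ℕ→ℚ z ^ℚ 2) * (α ^ℚ 2)) (energy≡pairs A B) hyp
    hypℕ : (a ℕ.* b) ℕ.^ 3 ℕ.≤ E ℕ.^ 2 ℕ.* k ℕ.^ 2
    hypℕ = natural-hypothesis {a ℕ.* b} {E} {k} 0≤α α≤k hypE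

    k>0 : 0 ℕ.< k
    k>0 = ℕ→ℚ-cancel {1} {k} (≤-trans 1≤α α≤k)

    K>0 : 0 ℕ.< K
    K>0 = subst (0 ℕ.<_) (sym (monomial-≡ K≡)) (*-pos {2 ℕ.^ 18} (ℕ.m^n>0 2 18) (ℕ.m^n>0 k {{ℕ.>-nonZero k>0}} 8))

    L = k ℕ.* k

    a²b≤ : a ℕ.* b ℕ.* a ℕ.≤ L ℕ.* E
    a²b≤ = energy-lower-bound {k = k} a>0 b>0 hypℕ (energy≤ab² A B)

    ab²≤ : a ℕ.* b ℕ.* b ℕ.≤ L ℕ.* E
    ab²≤ = subst (λ c → c ℕ.* b ℕ.≤ L ℕ.* E) (ℕ.*-comm b a) $
      energy-lower-bound {k = k} b>0 a>0 (subst (λ c → c ℕ.^ 3 ℕ.≤ E ℕ.^ 2 ℕ.* k ℕ.^ 2) (ℕ.*-comm a b) hypℕ)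
        (subst (λ c → E ℕ.≤ a ℕ.* c) (ℕ.*-comm a b) (energy≤a²b A B))

    E>0 : 0 ℕ.< E
    E>0 = proj₂ (*-pos⁻ L E (ℕ.<-≤-trans (*-pos (*-pos a>0 b>0) a>0) a²b≤))

    mk : Monomial k 0 1 k
    mk = monomial $ sym (trans (ℕ.*-identityˡ (k ℕ.^ 1)) (ℕ.*-identityʳ k))
    mL : Monomial k 0 2 L
    mL = monomial-* mk mk
    m2 : Monomial k 1 0 2
    m2 = monomial-2^ 1
    m4 : Monomial k 2 0 4
    m4 = monomial-2^ 2
    m64 : Monomial k 6 0 64
    m64 = monomial-2^ 6
    m2K : Monomial k 19 8 (2 ℕ.* K)
    m2K = monomial-* m2 K≡
    m2KK : Monomial k 37 16 (2 ℕ.* K ℕ.* K)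
    m2KK = monomial-* m2K K≡

    -- An equality: with L = k², 4(64L·4L)² = 2²(2⁸k⁴)² = 2¹⁸k⁸.
    K≥ : 4 ℕ.* (64 ℕ.* L ℕ.* (4 ℕ.* L) ℕ.* (64 ℕ.* L ℕ.* (4 ℕ.* L))) ℕ.≤ K
    K≥ = ℕ.≤-reflexive (trans (monomial-≡ (monomial-* m4 (monomial-* w w))) (sym (monomial-≡ K≡)))
      where
      w : Monomial k 8 4 (64 ℕ.* L ℕ.* (4 ℕ.* L))
      w = monomial-* (monomial-* m64 mL) (monomial-* m4 mL)

    -- Since 2K² = 2³⁷k¹⁶ and 2K = 2¹⁹k⁸, the exponents here are 205 = 1 + 5·37 + 19 and 88 = 5·16 +
    -- 8. With k ≤ 2α the four constants are at most 2²⁹³α⁸⁸, 2¹⁰⁶α³², 2³²α¹⁰ and 2³⁴⁵α¹⁰⁴, well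
    -- within the required bounds.
    M₁ : Monomial k 205 88 (2 ℕ.* ((2 ℕ.* K ℕ.* K) ℕ.^ 5 ℕ.* (2 ℕ.* K)))
    M₁ = monomial-* m2 (monomial-* (monomial-^ 5 m2KK) m2K)
    M₂ : Monomial k 74 32 ((2 ℕ.* K ℕ.* K) ℕ.^ 2)
    M₂ = monomial-^ 2 m2KK
    M₃ : Monomial k 22 10 (4 ℕ.* L ℕ.* 2 ℕ.* (2 ℕ.* K))
    M₃ = monomial-* (monomial-* (monomial-* m4 mL) m2) m2K
    M₄ : Monomial k 241 104 ((2 ℕ.* K ℕ.* K) ℕ.^ 6 ℕ.* (2 ℕ.* K))
    M₄ = monomial-* (monomial-^ 6 m2KK) m2K

    1≤monomial : ∀ {e f c} → Monomial k e f c → 1ℚ ≤ ℕ→ℚ c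
    1≤monomial {e} {f} {c} M = ℕ→ℚ-mono {1} {c} $ subst (0 ℕ.<_) (sym (monomial-≡ M))
      (*-pos (ℕ.m^n>0 2 e) (ℕ.m^n>0 k {{ℕ.>-nonZero k>0}} f))

    upper : ∀ {e f c} → Monomial k e f c → ∀ E F → {True (e ℕ.+ f ℕ.≤? E)} → {True (f ℕ.≤? F)} →
      ℕ→ℚ c ≤ (ℕ→ℚ 2 ^ℚ E) * (α ^ℚ F)
    upper M E F {p} {q} = monomial-≤ 1≤α k≤2α M E F (toWitness p) (toWitness q)

    β₂a≤ : ∀ c₂ → ℕ→ℚ c₂ * ℕ→ℚ a ≤ ℕ→ℚ c₂ * (α ^ℚ 2) * ℕ→ℚ b
    β₂a≤ c₂ = ≤-trans
      (ℚ.*-monoˡ-≤-nonNeg (ℕ→ℚ c₂) {{nonNegative (0≤ℕ→ℚ c₂)}}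
        (ratio-bound {a} {b} {E} {α} a>0 b>0 hypE 0≤α (energy≤ab² A B)))
      (≤-reflexive (sym (ℚ.*-assoc (ℕ→ℚ c₂) (α ^ℚ 2) (ℕ→ℚ b))))

  private
    -- The constants are variables known only through their monomial forms, so the passage to ℚ
    -- never meets the large expressions themselves.
    rationalise : ∀ {c₁ c₂ c₃ c₄} →
      Monomial k 205 88 c₁ → Monomial k 74 32 c₂ → Monomial k 22 10 c₃ → Monomial k 241 104 c₄ →
      (Σ (Subset n) λ H → Σ (Fin n) λ x → Σ (Fin n) λ y →
        IsApproxSubgroup G (ℕ→ℚ c₁) H ×
        ∣ H ∣ ℕ.≤ c₂ ℕ.* a ×
        a ℕ.≤ c₃ ℕ.* ∣ A ∩ leftTr G x H ∣ ×
        b ℕ.≤ c₃ ℕ.* ∣ B ∩ rightTr G H y ∣ ×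
        ∣ prodSet G (prodSet G H H) H ∣ ℕ.≤ c₄ ℕ.* ∣ H ∣) →
      ControlledByApproxSubgroup G α A B
    rationalise {c₁} {c₂} {c₃} {c₄} M₁ M₂ M₃ M₄ (H , x , y , approx , H≤ , A≤ , B≤ , H³≤) =
      ℕ→ℚ c₁ , ℕ→ℚ c₂ , ℕ→ℚ c₃ , ℕ→ℚ c₄ ,
      (1≤monomial M₁ , 1≤monomial M₂ , 1≤monomial M₃ , 1≤monomial M₄) ,
      (upper M₁ 1861 720 , upper M₂ 325 126 , upper M₃ 2424 937 , upper M₄ 930 360) ,
      H , x , y , approx ,
      ℕ→ℚ-≤-* c₂ a H≤ , β₂a≤ c₂ ,
      ℕ→ℚ-≤-* c₃ (∣ A ∩ leftTr G x H ∣) A≤ ,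
      ℕ→ℚ-≤-* c₃ (∣ B ∩ rightTr G H y ∣) B≤ ,
      ℕ→ℚ-≤-* c₄ (∣ H ∣) H³≤

  controlled-by-approx-subgroup : ControlledByApproxSubgroup G α A B
  controlled-by-approx-subgroup = rationalise M₁ M₂ M₃ M₄ (energy-bsg A B L K a>0 b>0 E>0 K>0 a²b≤ ab²≤ K≥)

theorem2p1 : {n : ℕ} (G : FinGroup n) (α : ℚ) → 1ℚ ≤ α →
    (A B : Subset n) → Nonempty A → Nonempty B →
    -- e(A,B) ≥ α⁻¹, i.e. E(A,B) · α ≥ (|A||B|)^{3/2}, squared:
    ℕ→ℚ (∣ A ∣ Data.Nat.* ∣ B ∣) ^ℚ 3 ≤ (ℕ→ℚ (energy G A B) ^ℚ 2) * (α ^ℚ 2) →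
    Σ ℚ λ β₁ → Σ ℚ λ β₂ → Σ ℚ λ β₃ → Σ ℚ λ β₄ →
      (1ℚ ≤ β₁ × 1ℚ ≤ β₂ × 1ℚ ≤ β₃ × 1ℚ ≤ β₄) ×
      (β₁ ≤ (ℕ→ℚ 2 ^ℚ 1861) * (α ^ℚ 720) ×
       β₂ ≤ (ℕ→ℚ 2 ^ℚ 325) * (α ^ℚ 126) ×
       β₃ ≤ (ℕ→ℚ 2 ^ℚ 2424) * (α ^ℚ 937) ×
       β₄ ≤ (ℕ→ℚ 2 ^ℚ 930) * (α ^ℚ 360)) ×
      Σ (Subset n) λ H → Σ (Fin n) λ x → Σ (Fin n) λ y →
        IsApproxSubgroup G β₁ H ×
        ℕ→ℚ ∣ H ∣ ≤ β₂ * ℕ→ℚ ∣ A ∣ ×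
        β₂ * ℕ→ℚ ∣ A ∣ ≤ β₂ * (α ^ℚ 2) * ℕ→ℚ ∣ B ∣ ×
        ℕ→ℚ ∣ A ∣ ≤ β₃ * ℕ→ℚ ∣ A ∩ leftTr G x H ∣ ×
        ℕ→ℚ ∣ B ∣ ≤ β₃ * ℕ→ℚ ∣ B ∩ rightTr G H y ∣ ×
        ℕ→ℚ ∣ prodSet G (prodSet G H H) H ∣ ≤ β₄ * ℕ→ℚ ∣ H ∣
theorem2p1 G α 1≤α A B A≠∅ B≠∅ hyp =
  let k , α≤k , k≤2α = natural-upper α 1≤α
  in controlled-by-approx-subgroup G α 1≤α A B A≠∅ B≠∅ hyp k α≤k k≤2α (2 ℕ.^ 18 ℕ.* k ℕ.^ 8) (monomial refl)
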